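{- Let $\mathcal I$ be a Borel ideal on $\omega$. The following conditions are equivalent: (1) the notions of P-point and $\mathcal I$-ultrafilter coincide; (2) $\mathcal I\le_K\mathrm{Fin}^2$ and $\mathcal I$ is not extendable to an $F_\sigma$ ideal (i.e. there is no $F_\sigma$ ideal $\mathcal I'$ on $\omega$ with $\mathcal I\subseteq\mathcal I'$).
   Context: An ideal on a set $X$ is a family of subsets of $X$ closed under finite unions and subsets, containing all finite subsets of $X$ and not containing $X$. Borel and $F_\sigma$ refer to the topology of $\mathcal P(\omega)\cong\{0,1\}^\omega$. $\mathrm{Fin}^2=\{A\subseteq\omega\times\omega:$ for all but finitely many $n$ the section $\{k:(n,k)\in A\}$ is finite$\}$. For ideals $\mathcal I$ on $X$ and $\mathcal K$ on $Y$, $\mathcal I\le_K\mathcal K$ (Katětov order) means that there is $f:Y\to X$ with $f^{ -1}[B]\in\mathcal K$ for all $B\in\mathcal I$. Ultrafilters on $\omega$ contain all cofinite sets; $\mathcal U^*=\{\omega\setminus A:A\in\mathcal U\}$. An ultrafilter $\mathcal U$ on $\omega$ is an $\mathcal I$-ultrafilter if $\mathcal I\not\le_K\mathcal U^*$. An ultrafilter $\mathcal U$ on $\omega$ is a P-point if for every countable $\mathcal A\subseteq\mathcal U^*$ there is $B\in\mathcal U$ with $A\cap B$ finite for all $A\in\mathcal A$.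
   Formalization: The implication (1)⇒(2) is proved assuming the Continuum Hypothesis, since without it the claim can fail: for I = Fin in a model with no P-points, (1) holds and (2) fails. The implication (2)⇒(1) is proved without it. -}

module Defs where

open import Data.List.Base using (List)
import Data.List.Membership.Propositional as List
open import Data.Nat.Base using (ℕ; _<_)
open import Data.Product.Base using (_×_; _,_; Σ-syntax; ∃-syntax)
open import Data.Sum.Base using (_⊎_)
open import Function.Bundles using (_⇔_)
open import Function.Definitions using (Congruent; Injective)
open import Level using (0ℓ)
open import Relation.Nullary.Negation.Core using (¬_)
open import Relation.Unary using (Pred; _∈_; _∉_; _⊆_; _≐_; ∅; U; ∁; _∪_; _∩_; ⋃; _⊢_)

private
  variable
    X Y : Set

𝒫 : Set → Set₁
𝒫 X = Pred X 0ℓ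

-- Two subsets are identified when they are related by _≐_.  A family is not
-- required to respect _≐_; ideals and ultrafilters do so by their closure
-- properties.
Family : Set → Set₁
Family X = Pred (𝒫 X) 0ℓ

Finite : 𝒫 X → Set
Finite {X} A = Σ[ xs ∈ List X ] A ⊆ (λ x → x List.∈ xs)

-- At most countable, the empty family included.
Countable : Family X → Set₁
Countable {X} 𝒜 = Σ[ e ∈ (ℕ → 𝒫 X) ] (∀ A → A ∈ 𝒜 → ∃[ n ] A ≐ e n)

record IsIdeal (I : Family X) : Set₁ where
  field
    finite∈  : ∀ {A} → Finite A → A ∈ I
    ⊆-closed : ∀ {A B} → A ⊆ B → B ∈ I → A ∈ I
    ∪-closed : ∀ {A B} → A ∈ I → B ∈ I → A ∪ B ∈ I
    proper   : U ∉ I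

AgreeBelow : ℕ → 𝒫 ℕ → 𝒫 ℕ → Set
AgreeBelow n A B = ∀ k → k < n → k ∈ A ⇔ k ∈ B

-- The product topology of {0,1}^ω, a subset being identified with its
-- characteristic function.
Open : Family ℕ → Set₁
Open S = ∀ A → A ∈ S → ∃[ n ] (∀ B → AgreeBelow n A B → B ∈ S)

Closed : Family ℕ → Set₁
Closed S = Open (∁ S)

Fσ : Family ℕ → Set₁
Fσ S = Σ[ F ∈ (ℕ → Family ℕ) ] (∀ n → Closed (F n)) × S ≐ ⋃ ℕ F

data Borel : Family ℕ → Set₁ where
  open-set   : ∀ {S} → Open S → Borel S
  complement : ∀ {S} → Borel S → Borel (∁ S)
  union      : ∀ {S : ℕ → Family ℕ} → (∀ n → Borel (S n)) → Borel (⋃ ℕ S)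
  resp-≐     : ∀ {S T} → S ≐ T → Borel S → Borel T

Fin² : Family (ℕ × ℕ)
Fin² A = Finite (λ n → ¬ Finite (λ k → (n , k) ∈ A))

infix 4 _≤K_

_≤K_ : Family X → Family Y → Set₁
_≤K_ {X} {Y} I K = Σ[ f ∈ (Y → X) ] (∀ B → B ∈ I → (f ⊢ B) ∈ K)

record IsUltrafilter (𝒰 : Family ℕ) : Set₁ where
  field
    cofinite∈ : ∀ {A} → Finite (∁ A) → A ∈ 𝒰
    ⊆-closed  : ∀ {A B} → A ⊆ B → A ∈ 𝒰 → B ∈ 𝒰
    ∩-closed  : ∀ {A B} → A ∈ 𝒰 → B ∈ 𝒰 → A ∩ B ∈ 𝒰
    proper    : ∅ ∉ 𝒰
    ultra     : ∀ A → A ∈ 𝒰 ⊎ ∁ A ∈ 𝒰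

-- B = ω ∖ A for some A ∈ 𝒰 if and only if ω ∖ B ∈ 𝒰.
_* : Family ℕ → Family ℕ
(𝒰 *) B = ∁ B ∈ 𝒰

_-ultrafilter_ : Family ℕ → Family ℕ → Set₁
I -ultrafilter 𝒰 = IsUltrafilter 𝒰 × ¬ (I ≤K 𝒰 *)

PPoint : Family ℕ → Set₁
PPoint 𝒰 = IsUltrafilter 𝒰 ×
  (∀ (𝒜 : Family ℕ) → Countable 𝒜 → 𝒜 ⊆ 𝒰 * →
    Σ[ B ∈ 𝒫 ℕ ] B ∈ 𝒰 × (∀ A → A ∈ 𝒜 → Finite (A ∩ B)))

PPointsCoincideWith : Family ℕ → Set₁
PPointsCoincideWith I = ∀ 𝒰 → PPoint 𝒰 ⇔ (I -ultrafilter 𝒰)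

FσExtendable : Family ℕ → Set₁
FσExtendable I = Σ[ J ∈ Family ℕ ] IsIdeal J × Fσ J × I ⊆ J

-- Every set of reals is countable or contains a copy of the continuum.
ContinuumHypothesis : Set₁
ContinuumHypothesis = ∀ (S : Family ℕ) →
  Countable S ⊎
  (Σ[ f ∈ (𝒫 ℕ → 𝒫 ℕ) ] Congruent _≐_ _≐_ f × Injective _≐_ _≐_ f × (∀ A → f A ∈ S))

-- (2) ⇒ (1).  If 𝒰 is not a P-point, a sequence in 𝒰* without pseudo-intersection gives
-- I ≤K Fin² ≤K 𝒰*.  If 𝒰 is a P-point and I ≤K 𝒰*, replace 𝒰 by its image so that I ⊆ 𝒰*.
-- Write I as the projection of a closed set.  If no Fσ set separated I from 𝒰, then in the
-- game where one player names sets in 𝒰 and the other cuts them off at finite stages, the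
-- first player could steer the union of the pieces into a member of I.  A P-point defeats
-- every such strategy; here two interleaved plays produce two members of I whose union
-- almost contains a member of 𝒰.  Hence I is covered by countably many closed subsets of
-- 𝒰*, and since 𝒰* is an ideal they generate an Fσ ideal, by compactness of 2^ω.
--
-- (1) ⇒ (2), under CH.  Sets positive for Fin² (modulo Fin²), and sets positive for an Fσ
-- ideal J (modulo finite), are σ-closed, so a tower of length ω₁ can meet continuum many
-- dense requirements.  If I ≰K Fin², the first tower generates an I-ultrafilter disjoint
-- from Fin², which is no P-point.  If I ⊆ J, the second one generates a P-point 𝒰 with
-- J ⊆ 𝒰*.
--
-- Excluded middle for all types is a global choice operator, from which Zermelo's theorem
-- supplies the well-ordering that CH cuts down to length ω₁.

module Submission where

open import Axiom.ExcludedMiddle using (ExcludedMiddle)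
open import Axiom.Extensionality.Propositional using (Extensionality; implicit-extensionality)
open import Data.Bool.Base using (Bool; true; false; T)
open import Data.Empty using (⊥; ⊥-elim)
open import Data.List.Base using (List; []; _∷_; _++_; filter; map; upTo)
import Data.List.Membership.Propositional as List
open import Data.List.Membership.Propositional.Properties
  using (∈-++⁺ˡ; ∈-++⁺ʳ; ∈-upTo⁺; ∈-filter⁺; ∈-filter⁻; ∈-map⁺)
open import Data.List.Relation.Unary.Any using (here; there)
open import Data.Nat.Base using (ℕ; zero; suc; _+_; _*_; _≤_; _<_; _⊔_; _∸_; z≤n; s≤s)
open import Data.Nat.Induction using (<-wellFounded)
open import Data.Nat.Properties
open import Data.Product.Base using (_×_; _,_; proj₁; proj₂; Σ-syntax; ∃-syntax; uncurry; map₁; map₂)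
open import Data.Sum.Base using (_⊎_; inj₁; inj₂; [_,_]′) renaming (map to map-⊎)
open import Function.Base using (id; _∘_; case_of_)
open import Function.Bundles using (_⇔_; mk⇔; Equivalence; _↣_; mk↣; Injection)
open import Induction.WellFounded using (WellFounded; WfRec; Acc; acc; module All; module FixPoint)
open import Level using (Level)
import Relation.Binary.Construct.On as On
open import Relation.Binary.Definitions using (tri<; tri≈; tri>)
open import Relation.Binary.PropositionalEquality using (_≡_; refl; sym; trans; cong; cong₂; subst)
open import Relation.Nullary.Decidable.Core using (yes; no; True; isYes; toWitness; fromWitness)
open import Relation.Nullary.Negation.Core using (¬_; contradiction)
open import Relation.Unary using (Pred; _∈_; _∉_; _⊆_; _≐_; U; ∁; _∪_; _∩_; _∖_; ⋃; _⊢_)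
open import Relation.Unary.Properties using (≐-sym; ≐-trans)
open import Defs

private
  variable
    ℓ ℓ′ : Level
    X Y : Set


Finite-⊆ : {A B : 𝒫 X} → A ⊆ B → Finite B → Finite A
Finite-⊆ A⊆B (xs , B⊆xs) = xs , λ a → B⊆xs (A⊆B a)

Finite-∪ : {A B : 𝒫 X} → Finite A → Finite B → Finite (A ∪ B)
Finite-∪ (xs , A⊆xs) (ys , B⊆ys) =
  xs ++ ys , λ { (inj₁ a) → ∈-++⁺ˡ (A⊆xs a) ; (inj₂ b) → ∈-++⁺ʳ xs (B⊆ys b) }

Finite-∅ : Finite {X} (λ _ → ⊥)
Finite-∅ = [] , λ ()

Bounded : 𝒫 ℕ → Set
Bounded A = ∃[ n ] (∀ k → k ∈ A → k < n)

bounded⇒finite : {A : 𝒫 ℕ} → Bounded A → Finite A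
bounded⇒finite (n , below) = upTo n , λ {k} k∈A → ∈-upTo⁺ (below k k∈A)

list-bounded : (xs : List ℕ) → Bounded (List._∈ xs)
list-bounded [] = 0 , λ _ ()
list-bounded (x ∷ xs) with n , below ← list-bounded xs = suc x ⊔ n , λ where
  k (here refl) → m≤m⊔n (suc x) n
  k (there k∈xs) → ≤-trans (below k k∈xs) (m≤n⊔m (suc x) n)

finite⇒bounded : {A : 𝒫 ℕ} → Finite A → Bounded A
finite⇒bounded (xs , A⊆xs) with n , below ← list-bounded xs = n , λ k k∈A → below k (A⊆xs k∈A)

ℕ-infinite : ¬ Finite {ℕ} U
ℕ-infinite fin with n , below ← finite⇒bounded fin = <-irrefl refl (below n _)

bound-values : (f : ℕ → ℕ) (m : ℕ) → ∃[ n ] (∀ k → k < m → f k < n)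
bound-values f zero = 0 , λ _ ()
bound-values f (suc m) with n , below ← bound-values f m = suc (f m) ⊔ n , λ k k<1+m →
  case m<1+n⇒m<n∨m≡n k<1+m of λ where
    (inj₁ k<m) → ≤-trans (below k k<m) (m≤n⊔m (suc (f m)) n)
    (inj₂ refl) → m≤m⊔n (suc (f m)) n

pair : ℕ → ℕ → ℕ
pair m n = (m + n) * (m + n) + n

pair-mono : ∀ m n m′ n′ → m + n < m′ + n′ → pair m n < pair m′ n′
pair-mono m n m′ n′ s<s′ = begin-strict
  s * s + n       ≤⟨ +-monoʳ-≤ (s * s) (m≤n+m n m) ⟩
  s * s + s       ≡⟨ +-comm (s * s) s ⟩
  suc s * s       <⟨ *-monoʳ-< (suc s) (n<1+n s) ⟩
  suc s * suc s   ≤⟨ *-mono-≤ s<s′ s<s′ ⟩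
  (m′ + n′) * (m′ + n′) ≤⟨ m≤m+n _ n′ ⟩
  pair m′ n′      ∎
  where
    open ≤-Reasoning
    s = m + n

pair-injective : ∀ {m n m′ n′} → pair m n ≡ pair m′ n′ → m ≡ m′ × n ≡ n′
pair-injective {m} {n} {m′} {n′} eq with <-cmp (m + n) (m′ + n′)
... | tri< s<s′ _ _ = contradiction eq (<⇒≢ (pair-mono m n m′ n′ s<s′))
... | tri> _ _ s>s′ = contradiction (sym eq) (<⇒≢ (pair-mono m′ n′ m n s>s′))
... | tri≈ _ s≡s′ _ = +-cancelʳ-≡ n m m′ (trans s≡s′ (cong (m′ +_) (sym n≡n′))) , n≡n′
  where
    n≡n′ : n ≡ n′
    n≡n′ = +-cancelˡ-≡ ((m + n) * (m + n)) n n′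
      (trans eq (cong (λ s → s * s + n′) (sym s≡s′)))

×-code : X ↣ ℕ → Y ↣ ℕ → (X × Y) ↣ ℕ
×-code c d = mk↣ {to = λ (x , y) → pair (C.to x) (D.to y)} λ eq →
  let eq₁ , eq₂ = pair-injective eq in cong₂ _,_ (C.injective eq₁) (D.injective eq₂)
  where
    module C = Injection c
    module D = Injection d

list-code : X ↣ ℕ → List X ↣ ℕ
list-code {X} c = mk↣ {to = code} (code-injective _ _)
  where
    module C = Injection c
    code : List X → ℕ
    code [] = 0
    code (x ∷ xs) = suc (pair (C.to x) (code xs))
    code-injective : ∀ xs ys → code xs ≡ code ys → xs ≡ ys
    code-injective [] [] _ = refl
    code-injective (x ∷ xs) (y ∷ ys) eq with eq₁ , eq₂ ← pair-injective (suc-injective eq) =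
      cong₂ _∷_ (C.injective eq₁) (code-injective xs ys eq₂)

ℕ-code : ℕ ↣ ℕ
ℕ-code = mk↣ {to = id} id

agree-refl : ∀ {n A} → AgreeBelow n A A
agree-refl _ _ = mk⇔ id id

agree-sym : ∀ {n A B} → AgreeBelow n A B → AgreeBelow n B A
agree-sym A~B k k<n = mk⇔ (Equivalence.from (A~B k k<n)) (Equivalence.to (A~B k k<n))

agree-trans : ∀ {n A B C} → AgreeBelow n A B → AgreeBelow n B C → AgreeBelow n A C
agree-trans A~B B~C k k<n =
  mk⇔ (Equivalence.to (B~C k k<n) ∘ Equivalence.to (A~B k k<n))
      (Equivalence.from (A~B k k<n) ∘ Equivalence.from (B~C k k<n))

agree-≤ : ∀ {m n A B} → m ≤ n → AgreeBelow n A B → AgreeBelow m A B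
agree-≤ m≤n A~B k k<m = A~B k (≤-trans k<m m≤n)

≐⇒agree : ∀ {n A B} → A ≐ B → AgreeBelow n A B
≐⇒agree (A⊆B , B⊆A) _ _ = mk⇔ A⊆B B⊆A

agree-suc : ∀ {n A B} → AgreeBelow n A B → n ∈ A ⇔ n ∈ B → AgreeBelow (suc n) A B
agree-suc A~B A⇔B k k<1+n = case m<1+n⇒m<n∨m≡n k<1+n of λ where
  (inj₁ k<n) → A~B k k<n
  (inj₂ refl) → A⇔B

Bool-ext : (∀ {a b} → Extensionality a b) → {f g : X → Bool} →
  (∀ x → T (f x) → T (g x)) → (∀ x → T (g x) → T (f x)) → f ≡ g
Bool-ext ext {f} {g} f⊆g g⊆f = ext λ x → T-injective (f x) (g x) (f⊆g x) (g⊆f x)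
  where
    T-injective : ∀ a b → (T a → T b) → (T b → T a) → a ≡ b
    T-injective false false _ _ = refl
    T-injective false true _ g = ⊥-elim (g _)
    T-injective true false f _ = ⊥-elim (f _)
    T-injective true true _ _ = refl

finite-⋃ : (F : ℕ → 𝒫 X) (n : ℕ) → (∀ i → i < n → Finite (F i)) → Finite (λ x → ∃[ i ] i < n × x ∈ F i)
finite-⋃ F zero fin = [] , λ ()
finite-⋃ F (suc n) fin = Finite-⊆
  (λ (i , i<1+n , x∈Fi) → case m<1+n⇒m<n∨m≡n i<1+n of λ where
    (inj₁ i<n) → inj₂ (i , i<n , x∈Fi)
    (inj₂ refl) → inj₁ x∈Fi)
  (Finite-∪ (fin n (n<1+n n)) (finite-⋃ F n λ i i<n → fin i (m<n⇒m<1+n i<n)))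

Column : 𝒫 (ℕ × ℕ) → ℕ → 𝒫 ℕ
Column A n k = (n , k) ∈ A

EqualBelow : ℕ → (ℕ → ℕ) → (ℕ → ℕ) → Set
EqualBelow n y z = ∀ k → k < n → y k ≡ z k

-- A presentation of S as the projection of a closed subset of 2^ω × ω^ω.
record Analytic (S : Family ℕ) : Set₁ where
  field
    graph    : 𝒫 ℕ → (ℕ → ℕ) → Set
    closed   : ∀ A y →
      (∀ n → Σ[ B ∈ 𝒫 ℕ ] Σ[ z ∈ (ℕ → ℕ) ] AgreeBelow n A B × EqualBelow n y z × graph B z) →
      graph A y
    sound    : ∀ {A y} → graph A y → A ∈ S
    complete : ∀ {A} → A ∈ S → ∃[ y ] graph A y

equal-≤ : ∀ {m n y z} → m ≤ n → EqualBelow n y z → EqualBelow m y z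
equal-≤ m≤n y~z k k<m = y~z k (≤-trans k<m m≤n)

equal-trans : ∀ {n x y z} → EqualBelow n x y → EqualBelow n y z → EqualBelow n x z
equal-trans x~y y~z k k<n = trans (x~y k k<n) (y~z k k<n)

FσSeparated : Pred (𝒫 ℕ) ℓ → Family ℕ → Set _
FσSeparated S 𝒰 = Σ[ F ∈ (ℕ → Family ℕ) ]
  (∀ n → Closed (F n)) × (∀ n A → A ∈ F n → A ∉ 𝒰) × (∀ A → A ∈ S → ∃[ n ] A ∈ F n)

separated-⊆ : {S : Pred (𝒫 ℕ) ℓ} {S′ : Pred (𝒫 ℕ) ℓ′} {𝒰 : Family ℕ} →
  (∀ A → A ∈ S → A ∈ S′) → FσSeparated S′ 𝒰 → FσSeparated S 𝒰
separated-⊆ S⊆S′ (F , closed , away , cover) = F , closed , away , λ A A∈S → cover A (S⊆S′ A A∈S)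

separated-empty : {S : Pred (𝒫 ℕ) ℓ} {𝒰 : Family ℕ} → (∀ A → A ∉ S) → FσSeparated S 𝒰
separated-empty empty =
  (λ _ _ → ⊥) , (λ _ _ _ → 0 , λ _ _ ()) , (λ _ _ ()) , λ A A∈S → contradiction A∈S (empty A)

separated-closed-∪ : {S : Pred (𝒫 ℕ) ℓ} {𝒰 L : Family ℕ} → Closed L → (∀ A → A ∈ L → A ∉ 𝒰) →
  FσSeparated S 𝒰 → FσSeparated (λ A → A ∈ L ⊎ A ∈ S) 𝒰
separated-closed-∪ {L = L} clL L-away (F , closed , away , cover) =
  F′ , (λ { zero → clL ; (suc n) → closed n }) , (λ { zero → L-away ; (suc n) → away n }) ,
  λ { A (inj₁ A∈L) → 0 , A∈L ; A (inj₂ A∈S) → let n , A∈F = cover A A∈S in suc n , A∈F }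
  where
    F′ : ℕ → Family ℕ
    F′ zero = L
    F′ (suc n) = F n

agree-∖ : ∀ {n A A′ B B′} → AgreeBelow n A A′ → AgreeBelow n B B′ → AgreeBelow n (A ∖ B) (A′ ∖ B′)
agree-∖ A~A′ B~B′ k k<n = mk⇔
  (λ (k∈A , k∉B) → Equivalence.to (A~A′ k k<n) k∈A , k∉B ∘ Equivalence.from (B~B′ k k<n))
  (λ (k∈A′ , k∉B′) → Equivalence.from (A~A′ k k<n) k∈A′ , k∉B′ ∘ Equivalence.to (B~B′ k k<n))

Finite-image : {A : 𝒫 X} (f : X → Y) → Finite A → Finite (λ y → ∃[ x ] x ∈ A × f x ≡ y)
Finite-image f (xs , A⊆xs) = map f xs , λ { (x , x∈A , refl) → ∈-map⁺ f (A⊆xs x∈A) }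

record Ω₁Order (X : Set) : Set₁ where
  infix 4 _≺_
  field
    _≺_         : X → X → Set
    wellFounded : WellFounded _≺_
    trichotomy  : ∀ x y → x ≺ y ⊎ x ≡ y ⊎ y ≺ x
    countable   : ∀ x → Σ[ e ∈ (ℕ → X) ] (∀ y → y ≺ x → ∃[ n ] e n ≡ y)

Finite-ideal : IsIdeal {ℕ} Finite
Finite-ideal = record
  { finite∈ = id ; ⊆-closed = λ A⊆B → Finite-⊆ A⊆B ; ∪-closed = Finite-∪ ; proper = ℕ-infinite }

decreasing-≤ : {E : ℕ → 𝒫 ℕ} → (∀ n → E (suc n) ⊆ E n) → ∀ {i j} → i ≤ j → E j ⊆ E i
decreasing-≤ {E} dec {i} {j} i≤j {k} k∈Ej = go (j ∸ i) (subst (λ l → k ∈ E l) (sym (m∸n+n≡m i≤j)) k∈Ej)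
  where
    go : ∀ d → k ∈ E (d + i) → k ∈ E i
    go zero k∈ = k∈
    go (suc d) k∈ = go d (dec (d + i) k∈)

module Classical (em : ∀ {ℓ} → ExcludedMiddle ℓ) (ext : ∀ {a b} → Extensionality a b) where

  dne : {P : Set ℓ} → ¬ ¬ P → P
  dne {P = P} ¬¬p with em {P = P}
  ... | yes p = p
  ... | no ¬p = contradiction ¬p ¬¬p

  ¬∀⇒∃¬ : {A : Set ℓ} {P : Pred A ℓ′} → ¬ (∀ x → P x) → ∃[ x ] ¬ P x
  ¬∀⇒∃¬ ¬∀ = dne λ ¬∃ → ¬∀ λ x → dne λ ¬Px → ¬∃ (x , ¬Px)

  ¬→⇒×¬ : {P : Set ℓ} {Q : Set ℓ′} → ¬ (P → Q) → P × ¬ Q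
  ¬→⇒×¬ ¬imp = dne (λ k → ¬imp λ p → contradiction (λ q → ¬imp λ _ → q) λ ¬q → k (p , ¬q))

  -- Excluded middle resizes propositions of any level to Set.
  ⌊_⌋ : Set ℓ → Set
  ⌊ P ⌋ = True (em {P = P})

  shrink : {P : Set ℓ} → P → ⌊ P ⌋
  shrink = fromWitness

  unshrink : {P : Set ℓ} → ⌊ P ⌋ → P
  unshrink = toWitness

  decode : X ↣ ℕ → X → ℕ → X
  decode c x₀ n with em {P = ∃[ x ] Injection.to c x ≡ n}
  ... | yes (x , _) = x
  ... | no _ = x₀

  decode-code : (c : X ↣ ℕ) (x₀ x : X) → decode c x₀ (Injection.to c x) ≡ x
  decode-code c x₀ x with em {P = ∃[ y ] Injection.to c y ≡ Injection.to c x}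
  ... | yes (_ , eq) = Injection.injective c eq
  ... | no ∄ = contradiction (x , refl) ∄

  infinite⇒unbounded : {A : 𝒫 ℕ} → ¬ Finite A → ∀ n → ∃[ k ] n ≤ k × k ∈ A
  infinite⇒unbounded inf n = dne λ ∄ → inf (bounded⇒finite (n , λ k k∈A →
    ≰⇒> λ n≤k → ∄ (k , n≤k , k∈A)))

  Limit : 𝒫 ℕ → Family ℕ → Set₁
  Limit A S = ∀ n → Σ[ B ∈ 𝒫 ℕ ] AgreeBelow n A B × B ∈ S

  closed⇒limit : ∀ {S} → Closed S → ∀ A → Limit A S → A ∈ S
  closed⇒limit clS A lim = dne λ A∉S →
    let n , far = clS A A∉S
        B , A~B , B∈S = lim n
    in far B A~B B∈S

  limit⇒closed : ∀ {S} → (∀ A → Limit A S → A ∈ S) → Closed S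
  limit⇒closed {S} lim A A∉S = dne λ ∄n → A∉S (lim A λ n →
    dne λ ∄B → ∄n (n , λ B A~B B∈S → ∄B (B , A~B , B∈S)))

  initial : 𝒫 ℕ → ℕ → List ℕ
  initial A n = filter (λ k → em {P = k ∈ A}) (upTo n)

  initial-agree : ∀ A n → AgreeBelow n (List._∈ initial A n) A
  initial-agree A n k k<n = mk⇔
    (λ k∈xs → proj₂ (∈-filter⁻ (λ k → em {P = k ∈ A}) {xs = upTo n} k∈xs))
    (∈-filter⁺ (λ k → em {P = k ∈ A}) (∈-upTo⁺ k<n))

  Unbounded : 𝒫 ℕ → Set
  Unbounded M = ∀ n → ∃[ k ] n ≤ k × k ∈ M

  module _ (c : ℕ → 𝒫 ℕ) where

    private
      chosen : ℕ → 𝒫 ℕ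
      cluster : 𝒫 ℕ

      chosen zero = U
      chosen (suc m) n = n ∈ chosen m × (cluster m ⇔ m ∈ c n)

      cluster m = Unbounded (λ n → n ∈ chosen m × m ∈ c n)

      chosen-unbounded : ∀ m → Unbounded (chosen m)
      chosen-unbounded zero n = n , ≤-refl , _
      chosen-unbounded (suc m) n with em {P = m ∈ cluster}
      ... | yes m∈C with k , n≤k , k∈M , m∈ck ← m∈C n =
        k , n≤k , k∈M , mk⇔ (λ _ → m∈ck) (λ _ → m∈C)
      ... | no m∉C with n₀ , none ← ¬∀⇒∃¬ m∉C
                   with k , n⊔n₀≤k , k∈M ← chosen-unbounded m (n ⊔ n₀) =
        k , m⊔n≤o⇒m≤o n n₀ n⊔n₀≤k , k∈M ,
        mk⇔ (λ m∈C → contradiction m∈C m∉C)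
            (λ m∈ck → contradiction (k , m⊔n≤o⇒n≤o n n₀ n⊔n₀≤k , k∈M , m∈ck) none)

      chosen-agree : ∀ m n → n ∈ chosen m → AgreeBelow m cluster (c n)
      chosen-agree zero n _ _ ()
      chosen-agree (suc m) n (n∈M , iff) = agree-suc (chosen-agree m n n∈M) iff

    cluster-point : Σ[ C ∈ 𝒫 ℕ ] (∀ m → ∃[ n ] m ≤ n × AgreeBelow m C (c n))
    cluster-point = cluster , λ m →
      let n , m≤n , n∈M = chosen-unbounded m m in n , m≤n , chosen-agree m n n∈M

  -- Ultrafilters and the Katětov order

  fin²⇒columns : ∀ {A} → A ∈ Fin² → ∃[ N ] (∀ n → N ≤ n → Finite (Column A n))
  fin²⇒columns fin with N , bad<N ← finite⇒bounded fin =
    N , λ n N≤n → dne λ inf → <⇒≱ (bad<N n inf) N≤n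

  columns⇒fin² : ∀ {A} N → (∀ n → N ≤ n → Finite (Column A n)) → A ∈ Fin²
  columns⇒fin² N fin = bounded⇒finite (N , λ n inf → ≰⇒> λ N≤n → inf (fin n N≤n))

  least : {P : 𝒫 ℕ} → ∃[ n ] n ∈ P → ∃[ n ] n ∈ P × (∀ m → m ∈ P → n ≤ m)
  least {P} (n , n∈P) = go n n∈P (<-wellFounded n)
    where
      go : ∀ n → n ∈ P → Acc _<_ n → ∃[ n ] n ∈ P × (∀ m → m ∈ P → n ≤ m)
      go n n∈P (acc rs) with em {P = ∃[ m ] m < n × m ∈ P}
      ... | yes (m , m<n , m∈P) = go m m∈P (rs m<n)
      ... | no none = n , n∈P , λ m m∈P → ≮⇒≥ λ m<n → none (m , m<n , m∈P)

  module Ultra {𝒰 : Family ℕ} (isU : IsUltrafilter 𝒰) where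
    open IsUltrafilter isU public

    disjoint : ∀ {A B} → A ∈ 𝒰 → B ∈ 𝒰 → ∃[ k ] k ∈ A × k ∈ B
    disjoint a b = dne λ ∄ → proper (⊆-closed (λ {k} (k∈A , k∈B) → ∄ (k , k∈A , k∈B)) (∩-closed a b))

    ∁∉ : ∀ {A} → A ∉ 𝒰 → ∁ A ∈ 𝒰
    ∁∉ {A} A∉U with ultra A
    ... | inj₁ A∈U = contradiction A∈U A∉U
    ... | inj₂ ∁A∈U = ∁A∈U

    ∁∈ : ∀ {A} → ∁ A ∈ 𝒰 → A ∉ 𝒰
    ∁∈ ∁A∈U A∈U with k , k∉A , k∈A ← disjoint ∁A∈U A∈U = k∉A k∈A

    *-⊆ : ∀ {A B} → A ⊆ B → B ∈ 𝒰 * → A ∈ 𝒰 *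
    *-⊆ A⊆B = ⊆-closed (λ k∉B k∈A → k∉B (A⊆B k∈A))

    *-∪ : ∀ {A B} → A ∈ 𝒰 * → B ∈ 𝒰 * → A ∪ B ∈ 𝒰 *
    *-∪ a b = ⊆-closed (λ (k∉A , k∉B) → [ k∉A , k∉B ]′) (∩-closed a b)

    ∖-closed : ∀ {A B} → A ∈ 𝒰 → B ∈ 𝒰 * → A ∖ B ∈ 𝒰
    ∖-closed = ∩-closed

  ≤K-trans : ∀ {X Y Z : Set} {I : Family X} {J : Family Y} {K : Family Z} → I ≤K J → J ≤K K → I ≤K K
  ≤K-trans (f , f-red) (g , g-red) = (λ z → f (g z)) , λ B B∈I → g-red (f ⊢ B) (f-red B B∈I)

  -- A countable subfamily of 𝒰* without a pseudo-intersection, disjointified, supplies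
  -- the columns of a Katětov reduction of Fin².
  no-pseudointersection⇒Fin²≤K : ∀ {𝒰} → IsUltrafilter 𝒰 → (𝒜 : Family ℕ) → Countable 𝒜 → 𝒜 ⊆ 𝒰 * →
    ¬ (Σ[ B ∈ 𝒫 ℕ ] B ∈ 𝒰 × (∀ A → A ∈ 𝒜 → Finite (A ∩ B))) → Fin² ≤K 𝒰 *
  no-pseudointersection⇒Fin²≤K {𝒰} isU 𝒜 (e , enum) 𝒜⊆𝒰* none =
    (λ k → ν k , k) , λ B B∈Fin² → ∁∉ λ C∈𝒰 →
      let N , fin = fin²⇒columns B∈Fin² in
      none ((λ k → (ν k , k) ∈ B × ¬ ν k < N) , ∖-closed C∈𝒰 (ν<-small N) , λ A A∈𝒜 →
        let n , A≐en = enum A A∈𝒜 in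
        Finite-⊆
          (λ {k} (k∈A , k∈B , ν≮N) → ν k ,
            s≤s (ν-least k n (⊆-closed (λ k∉A k∈e → k∉A (proj₂ A≐en k∈e)) (𝒜⊆𝒰* A∈𝒜) , proj₁ A≐en k∈A)) ,
            ≮⇒≥ ν≮N , k∈B)
          (finite-⋃ (λ i k → N ≤ i × (i , k) ∈ B) (suc n) λ i _ →
            case N ≤? i of λ where
              (yes N≤i) → Finite-⊆ proj₂ (fin i N≤i)
              (no N≰i) → Finite-⊆ (λ (N≤i , _) → contradiction N≤i N≰i) Finite-∅))
    where
      open Ultra isU

      E : ℕ → 𝒫 ℕ
      E n k = e n ∈ 𝒰 * × k ∈ e n

      E∈𝒰* : ∀ n → E n ∈ 𝒰 *
      E∈𝒰* n = ∁∉ λ E∈𝒰 → let _ , (en∈𝒰* , _) , _ = disjoint E∈𝒰 E∈𝒰 in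
        ∁∈ en∈𝒰* (⊆-closed proj₂ E∈𝒰)

      first : ∀ k → Σ[ n ∈ ℕ ] (∀ m → k ∈ E m → n ≤ m) × (k ∈ E n ⊎ (∀ m → k ∉ E m))
      first k with em {P = ∃[ n ] k ∈ E n}
      ... | yes some with n , k∈En , min ← least some = n , min , inj₁ k∈En
      ... | no ∄ = 0 , (λ _ _ → z≤n) , inj₂ λ m k∈Em → ∄ (m , k∈Em)

      ν : ℕ → ℕ
      ν k = proj₁ (first k)

      ν-least : ∀ k n → k ∈ E n → ν k ≤ n
      ν-least k = proj₁ (proj₂ (first k))

      rest∈𝒰* : (λ k → ∀ m → k ∉ E m) ∈ 𝒰 *
      rest∈𝒰* = ∁∉ λ R∈𝒰 → none (_ , R∈𝒰 , λ A A∈𝒜 →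
        let n , A≐en = enum A A∈𝒜 in
        Finite-⊆
          (λ {k} (k∈A , k∈R) → k∈R n
            (⊆-closed (λ k∉A k∈e → k∉A (proj₂ A≐en k∈e)) (𝒜⊆𝒰* A∈𝒜) , proj₁ A≐en k∈A))
          Finite-∅)

      ν<-small : ∀ N → (λ k → ν k < N) ∈ 𝒰 *
      ν<-small zero = cofinite∈ (Finite-⊆ (λ k≮0 → k≮0 λ ()) Finite-∅)
      ν<-small (suc N) = *-⊆
        (λ {k} ν<1+N → case m<1+n⇒m<n∨m≡n ν<1+N of λ where
          (inj₁ ν<N) → inj₁ ν<N
          (inj₂ ν≡N) → inj₂ (case proj₂ (proj₂ (first k)) of λ where
            (inj₁ k∈Eν) → inj₁ (subst (λ n → k ∈ E n) ν≡N k∈Eν)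
            (inj₂ k∈R) → inj₂ k∈R))
        (*-∪ (ν<-small N) (*-∪ (E∈𝒰* N) rest∈𝒰*))

  I-ultrafilter⇒PPoint : ∀ {I 𝒰} → I ≤K Fin² → I -ultrafilter 𝒰 → PPoint 𝒰
  I-ultrafilter⇒PPoint {𝒰 = 𝒰} I≤Fin² (isU , I≰𝒰*) = isU , λ 𝒜 countable 𝒜⊆𝒰* → dne λ none →
    I≰𝒰* (≤K-trans {K = 𝒰 *} I≤Fin² (no-pseudointersection⇒Fin²≤K isU 𝒜 countable 𝒜⊆𝒰* none))

  -- Analytic sets

  closed-analytic : ∀ {S} → Closed S → Analytic S
  closed-analytic {S} clS = record
    { graph = λ A _ → A ∈ S
    ; closed = λ A _ lim → closed⇒limit clS A λ n → let B , _ , A~B , _ , B∈S = lim n in B , A~B , B∈S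
    ; sound = id
    ; complete = λ A∈S → (λ _ → 0) , A∈S
    }

  open-analytic : ∀ {S} → Open S → Analytic S
  open-analytic {S} opS = record
    { graph = λ A y → ⌊ (∀ B → AgreeBelow (y 0) A B → B ∈ S) ⌋
    ; closed = λ A y lim →
        let B , z , A~B , y~z , ball⊆S = lim (suc (y 0)) in
        shrink λ D A~D → unshrink ball⊆S D (subst (λ n → AgreeBelow n B D) (y~z 0 (s≤s z≤n))
          (agree-trans (agree-sym (agree-≤ (n≤1+n (y 0)) A~B)) A~D))
    ; sound = λ ball⊆S → unshrink ball⊆S _ agree-refl
    ; complete = λ {A} A∈S → let n , ball⊆S = opS A A∈S in (λ _ → n) , shrink ball⊆S
    }

  ⋃-analytic : ∀ {S : ℕ → Family ℕ} → (∀ n → Analytic (S n)) → Analytic (⋃ ℕ S)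
  ⋃-analytic {S} an = record
    { graph = λ A y → An.graph (y 0) A (y ∘ suc)
    ; closed = λ A y lim → An.closed (y 0) A (y ∘ suc) λ n →
        let B , z , A~B , y~z , B∈ = lim (suc n) in
        B , z ∘ suc , agree-≤ (n≤1+n n) A~B , (λ k k<n → y~z (suc k) (s≤s k<n)) ,
        subst (λ i → An.graph i B (z ∘ suc)) (sym (y~z 0 (s≤s z≤n))) B∈
    ; sound = λ {_} {y} A∈ → y 0 , An.sound (y 0) A∈
    ; complete = λ (n , A∈Sn) → let y , A∈ = An.complete n A∈Sn in
        (λ { zero → n ; (suc k) → y k }) , A∈
    }
    where module An n = Analytic (an n)

  ⋂-analytic : ∀ {S : ℕ → Family ℕ} → (∀ n → Analytic (S n)) → Analytic (λ A → ∀ n → A ∈ S n)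
  ⋂-analytic {S} an = record
    { graph = λ A y → ∀ i → An.graph i A (row y i)
    ; closed = λ A y lim i → An.closed i A (row y i) λ n →
        let N , bound = bound-values (pair i) n
            B , z , A~B , y~z , B∈ = lim (n ⊔ N)
        in B , row z i , agree-≤ (m≤m⊔n n N) A~B ,
           (λ k k<n → y~z (pair i k) (≤-trans (bound k k<n) (m≤n⊔m n N))) , B∈ i
    ; sound = λ A∈ i → An.sound i (A∈ i)
    ; complete = λ {A} A∈S →
        let y : ℕ → ℕ → ℕ
            y i = proj₁ (An.complete i (A∈S i))
        in merge y , λ i → An.closed i A (row (merge y) i) λ n →
           A , y i , agree-refl , (λ k _ → row-merge y i k) , proj₂ (An.complete i (A∈S i))
    }
    where
      module An n = Analytic (an n)
      row : (ℕ → ℕ) → ℕ → ℕ → ℕ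
      row y i k = y (pair i k)
      merge : (ℕ → ℕ → ℕ) → ℕ → ℕ
      merge y n = uncurry y (decode (×-code ℕ-code ℕ-code) (0 , 0) n)
      row-merge : ∀ y i k → row (merge y) i k ≡ y i k
      row-merge y i k = cong (uncurry y) (decode-code (×-code ℕ-code ℕ-code) (0 , 0) (i , k))

  ≐-analytic : ∀ {S S′} → S ≐ S′ → Analytic S → Analytic S′
  ≐-analytic (S⊆S′ , S′⊆S) an = record
    { graph = graph ; closed = closed ; sound = S⊆S′ ∘ sound ; complete = complete ∘ S′⊆S }
    where open Analytic an

  borel⇒analytic : ∀ {S} → Borel S → Analytic S × Analytic (∁ S)
  borel⇒analytic (open-set {S} opS) =
    open-analytic opS , closed-analytic λ A A∈S →
      let n , ball⊆S = opS A (dne A∈S) in n , λ B A~B B∉S → B∉S (ball⊆S B A~B)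
  borel⇒analytic (complement b) with an , an∁ ← borel⇒analytic b =
    an∁ , ≐-analytic ((λ A∈S A∉S → A∉S A∈S) , dne) an
  borel⇒analytic (union b) =
    ⋃-analytic (λ n → proj₁ (borel⇒analytic (b n))) ,
    ≐-analytic ((λ A∉ (n , A∈) → A∉ n A∈) , λ A∉ n A∈ → A∉ (n , A∈))
      (⋂-analytic λ n → proj₂ (borel⇒analytic (b n)))
  borel⇒analytic (resp-≐ (S⊆T , T⊆S) b) with an , an∁ ← borel⇒analytic b =
    ≐-analytic (S⊆T , T⊆S) an , ≐-analytic ((λ A∉S A∈T → A∉S (T⊆S A∈T)) , λ A∉T A∈S → A∉T (S⊆T A∈S)) an∁

  -- Separation of analytic sets from ultrafilters by Fσ sets

  reindex : X ↣ ℕ → (X → Family ℕ) → ℕ → Family ℕ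
  reindex c F n A = ∃[ x ] Injection.to c x ≡ n × A ∈ F x

  reindex-closed : (c : X ↣ ℕ) (F : X → Family ℕ) → (∀ x → Closed (F x)) → ∀ n → Closed (reindex c F n)
  reindex-closed c F closed n = limit⇒closed λ A lim →
    let _ , _ , x , x↦n , _ = lim 0 in
    x , x↦n , closed⇒limit (closed x) A λ m →
      let B , A~B , x′ , x′↦n , B∈F = lim m in
      B , A~B , subst (λ x → B ∈ F x) (Injection.injective c (trans x′↦n (sym x↦n))) B∈F

  separated-⋃ : X ↣ ℕ → {S : X → Pred (𝒫 ℕ) ℓ} {𝒰 : Family ℕ} →
    (∀ x → FσSeparated (S x) 𝒰) → FσSeparated (λ A → ∃[ x ] A ∈ S x) 𝒰
  separated-⋃ c sep =
    reindex code F , reindex-closed code F (λ (x , n) → closed x n) ,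
    (λ { n A ((x , i) , _ , A∈F) → away x i A A∈F }) ,
    λ { A (x , A∈S) → let i , A∈F = cover x A A∈S in _ , (x , i) , refl , A∈F }
    where
      code = ×-code c ℕ-code
      F = λ (x , n) → proj₁ (sep x) n
      closed = λ x → proj₁ (proj₂ (sep x))
      away = λ x → proj₁ (proj₂ (proj₂ (sep x)))
      cover = λ x → proj₂ (proj₂ (proj₂ (sep x)))

  record Node : Set₁ where
    constructor node
    field
      approx : 𝒫 ℕ
      bits   : ℕ
      path   : ℕ → ℕ
      depth  : ℕ

  open Node

  record _⊑_ (N M : Node) : Set where
    field
      bits<  : bits N < bits M
      approx~ : AgreeBelow (bits N) (approx N) (approx M)
      depth<  : depth N < depth M
      path~   : EqualBelow (depth N) (path N) (path M)

  open _⊑_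

  module _ {S : Family ℕ} (analytic : Analytic S) where
    open Analytic analytic

    Below : Node → Family ℕ
    Below N A = AgreeBelow (bits N) (approx N) A × ∃[ y ] EqualBelow (depth N) (path N) y × graph A y

    branch-limit : (N : ℕ → Node) → (∀ k → N k ⊑ N (suc k)) → (∀ k → Σ[ A ∈ 𝒫 ℕ ] A ∈ Below (N k)) →
      Σ[ A ∈ 𝒫 ℕ ] A ∈ S × (∀ k → AgreeBelow (bits (N k)) (approx (N k)) A)
    branch-limit N step nonempty = limit , sound (closed limit y λ k →
        let A , N~A , z , path~z , A,z∈ = nonempty k in
        A , z , agree-≤ (k≤bits k) (agree-trans (agree-sym (approx~limit k)) N~A) ,
        equal-≤ (k≤depth k) (equal-trans (λ i i<d → sym (path~y k i i<d)) path~z) , A,z∈) ,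
      approx~limit
      where
        bits-≤ : ∀ k d → bits (N k) ≤ bits (N (d + k))
        bits-≤ k zero = ≤-refl
        bits-≤ k (suc d) = ≤-trans (bits-≤ k d) (<⇒≤ (bits< (step (d + k))))

        depth-≤ : ∀ k d → depth (N k) ≤ depth (N (d + k))
        depth-≤ k zero = ≤-refl
        depth-≤ k (suc d) = ≤-trans (depth-≤ k d) (<⇒≤ (depth< (step (d + k))))

        approx-stable : ∀ k d → AgreeBelow (bits (N k)) (approx (N k)) (approx (N (d + k)))
        approx-stable k zero = agree-refl
        approx-stable k (suc d) =
          agree-trans (approx-stable k d) (agree-≤ (bits-≤ k d) (approx~ (step (d + k))))

        path-stable : ∀ k d → EqualBelow (depth (N k)) (path (N k)) (path (N (d + k)))
        path-stable k zero _ _ = refl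
        path-stable k (suc d) =
          equal-trans (path-stable k d) (equal-≤ (depth-≤ k d) (path~ (step (d + k))))

        k≤bits : ∀ k → k ≤ bits (N k)
        k≤bits zero = z≤n
        k≤bits (suc k) = ≤-trans (s≤s (k≤bits k)) (bits< (step k))

        k≤depth : ∀ k → k ≤ depth (N k)
        k≤depth zero = z≤n
        k≤depth (suc k) = ≤-trans (s≤s (k≤depth k)) (depth< (step k))

        limit : 𝒫 ℕ
        limit j = j ∈ approx (N (suc j))

        y : ℕ → ℕ
        y i = path (N (suc i)) i

        approx~limit : ∀ k → AgreeBelow (bits (N k)) (approx (N k)) limit
        approx~limit k j j<b with ≤-total k (suc j)
        ... | inj₁ k≤1+j = subst (λ l → j ∈ approx (N k) ⇔ j ∈ approx (N l))
          (m∸n+n≡m k≤1+j) (approx-stable k (suc j ∸ k) j j<b)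
        ... | inj₂ 1+j≤k = subst (λ l → j ∈ approx (N l) ⇔ j ∈ limit)
          (m∸n+n≡m 1+j≤k) (agree-sym (approx-stable (suc j) (k ∸ suc j)) j (k≤bits (suc j)))

        path~y : ∀ k → EqualBelow (depth (N k)) (path (N k)) y
        path~y k i i<d with ≤-total k (suc i)
        ... | inj₁ k≤1+i = subst (λ l → path (N k) i ≡ path (N l) i)
          (m∸n+n≡m k≤1+i) (path-stable k (suc i ∸ k) i i<d)
        ... | inj₂ 1+i≤k = subst (λ l → path (N l) i ≡ y i)
          (m∸n+n≡m 1+i≤k) (sym (path-stable (suc i) (k ∸ suc i) i (k≤depth (suc i))))

    module _ (𝒰 : Family ℕ) where

      Inseparable : Node → Set₁
      Inseparable N = ¬ FσSeparated (Below N) 𝒰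

      inseparable⇒nonempty : ∀ {N} → Inseparable N → Σ[ A ∈ 𝒫 ℕ ] A ∈ Below N
      inseparable⇒nonempty insep = dne λ empty → insep (separated-empty λ A A∈ → empty (A , A∈))

      Fork : Node → 𝒫 ℕ → Set₁
      Fork N u = u ∈ 𝒰 × AgreeBelow (bits N) (approx N) u ×
        (∀ m → Σ[ t ∈ (ℕ → ℕ) ] EqualBelow (depth N) (path N) t ×
          Inseparable (node u m t (suc (depth N))))

      -- Otherwise every u ∈ 𝒰 has a basic neighbourhood in which N is separated from 𝒰.
      -- There are countably many such neighbourhoods, and what they leave uncovered is
      -- closed and misses 𝒰.
      fork : ∀ N → Inseparable N → Σ[ u ∈ 𝒫 ℕ ] Fork N u
      fork N@(node x b t d) insep = dne λ none → insep (separated-⊆ split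
        (separated-closed-∪ remainder-closed (remainder-away none)
          (separated-⋃ (×-code ℕ-code (list-code ℕ-code)) piece-separated)))
        where
          cylinder : ℕ × List ℕ → Node
          cylinder (m , xs) = node (List._∈ xs) m t d

          Piece : ℕ × List ℕ → Pred (𝒫 ℕ) _
          Piece w A = FσSeparated (Below (cylinder w)) 𝒰 × A ∈ Below (cylinder w)

          piece-separated : ∀ w → FσSeparated (Piece w) 𝒰
          piece-separated w with em {P = FσSeparated (Below (cylinder w)) 𝒰}
          ... | yes sep = separated-⊆ (λ _ → proj₂) sep
          ... | no insep = separated-empty λ A (sep , _) → insep sep

          Remainder : Family ℕ
          Remainder A = AgreeBelow b x A ×
            ⌊ (∀ w → FσSeparated (Below (cylinder w)) 𝒰 → ¬ AgreeBelow (proj₁ w) (List._∈ proj₂ w) A) ⌋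

          remainder-closed : Closed Remainder
          remainder-closed = limit⇒closed λ A lim →
            (let B , A~B , x~B , _ = lim b in agree-trans x~B (agree-sym A~B)) ,
            shrink λ w sep w~A → let B , A~B , _ , avoid = lim (proj₁ w) in
              unshrink avoid w sep (agree-trans w~A A~B)

          extend : ℕ → ℕ → ℕ
          extend k i with i <? d
          ... | yes _ = t i
          ... | no _ = k

          extend~t : ∀ k → EqualBelow d t (extend k)
          extend~t k i i<d with i <? d
          ... | yes _ = refl
          ... | no i≮d = contradiction i<d i≮d

          extend~y : ∀ y → EqualBelow d t y → EqualBelow (suc d) (extend (y d)) y
          extend~y y t~y i i<1+d with i <? d
          ... | yes i<d = t~y i i<d
          ... | no i≮d with refl ← ≤-antisym (≮⇒≥ i≮d) (≤-pred i<1+d) = refl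

          separated-near : ¬ (Σ[ u ∈ 𝒫 ℕ ] Fork N u) → ∀ {u} → u ∈ 𝒰 → AgreeBelow b x u →
            ∃[ m ] FσSeparated (Below (node u m t d)) 𝒰
          separated-near none {u} u∈𝒰 x~u =
            let m , none-m = ¬∀⇒∃¬ λ all → none (u , u∈𝒰 , x~u , all) in
            m , separated-⊆ (λ A (u~A , y , t~y , A,y∈) → y d , u~A , y , extend~y y t~y , A,y∈)
              (separated-⋃ ℕ-code λ k → dne λ insep → none-m (extend k , extend~t k , insep))

          remainder-away : ¬ (Σ[ u ∈ 𝒫 ℕ ] Fork N u) → ∀ u → u ∈ Remainder → u ∉ 𝒰
          remainder-away none u (x~u , avoid) u∈𝒰 =
            let m , sep = separated-near none u∈𝒰 x~u in
            unshrink avoid (m , initial u m)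
              (separated-⊆
                (λ A (xs~A , rest) → agree-trans (agree-sym (initial-agree u m)) xs~A , rest) sep)
              (initial-agree u m)

          split : ∀ A → A ∈ Below N → A ∈ Remainder ⊎ (∃[ w ] A ∈ Piece w)
          split A (x~A , y∈) with em {P = ∃[ w ] FσSeparated (Below (cylinder w)) 𝒰 ×
                                                 AgreeBelow (proj₁ w) (List._∈ proj₂ w) A}
          ... | yes (w , sep , w~A) = inj₂ (w , sep , w~A , y∈)
          ... | no ∄ = inj₁ (x~A , shrink λ w sep w~A → ∄ (w , sep , w~A))

  pseudo-intersection : ∀ {𝒰} → PPoint 𝒰 → X ↣ ℕ → (u : X → 𝒫 ℕ) → (∀ x → u x ∈ 𝒰) →
    Σ[ B ∈ 𝒫 ℕ ] B ∈ 𝒰 × (∀ x → Bounded (B ∖ u x))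
  pseudo-intersection {X = X} (isU , pp) c u u∈𝒰 =
    let B , B∈𝒰 , fin = pp 𝒜 countable (λ (x , A≐) → ⊆-closed (λ k∈u k∈A → proj₁ A≐ k∈A k∈u) (u∈𝒰 x)) in
    B , B∈𝒰 , λ x → finite⇒bounded (Finite-⊆ (λ (k∈B , k∉u) → k∉u , k∈B) (fin (∁ (u x)) (x , id , id)))
    where
      open IsUltrafilter isU
      𝒜 : Family ℕ
      𝒜 A = ∃[ x ] A ≐ ∁ (u x)
      countable : Countable 𝒜
      countable = (λ n k → ∃[ x ] Injection.to c x ≡ n × k ∉ u x) , λ A (x , A⊆ , A⊇) →
        Injection.to c x , (λ k∈A → x , refl , A⊆ k∈A) ,
        λ {k} (x′ , eq , k∉u) → A⊇ (subst (λ x → k ∉ u x) (Injection.injective c eq) k∉u)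

  -- Two plays whose moves alternate: after each of its moves a play follows B up to its
  -- next move, once past the point where B is contained in its current answer.  The
  -- interval that a play skips while waiting for that point is covered by the other play.
  module Interleaving {I : Family ℕ} (isI : IsIdeal I) {B : 𝒫 ℕ}
    (at : List ℕ → Node) (bits-at : ∀ m ms → bits (at (m ∷ ms)) ≡ m) (bits-root : bits (at []) ≡ 0)
    (at-⊑ : ∀ m ms → bits (at ms) < m → at ms ⊑ at (m ∷ ms))
    (branch : (p : ℕ → List ℕ) → (∀ k → at (p k) ⊑ at (p (suc k))) →
      Σ[ A ∈ 𝒫 ℕ ] A ∈ I × (∀ k → AgreeBelow (bits (at (p k))) (approx (at (p k))) A))
    (from : List ℕ → ℕ)
    (from-⊆ : ∀ m ms k → k ∈ B → from ms ≤ k → k ∈ approx (at (m ∷ ms)))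
    where

    open IsIdeal isI

    root≤ : bits (at []) ≤ from []
    root≤ = subst (_≤ from []) (sym bits-root) z≤n

    record State : Set where
      field
        left right : List ℕ
        bound      : ℕ
        left≤      : bits (at left) ≤ bound
        right≤     : bits (at right) ≤ bound
        from≤      : from right ≤ bound

    open State

    middle : State → ℕ
    middle σ = suc (bound σ) ⊔ from (left σ)

    right′ : State → List ℕ
    right′ σ = middle σ ∷ right σ

    bound′ : State → ℕ
    bound′ σ = suc (middle σ) ⊔ from (right′ σ)

    bound<middle : ∀ σ → bound σ < middle σ
    bound<middle σ = m≤m⊔n (suc (bound σ)) (from (left σ))

    middle<bound′ : ∀ σ → middle σ < bound′ σ
    middle<bound′ σ = m≤m⊔n (suc (middle σ)) (from (right′ σ))

    advance : State → State
    advance σ = record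
      { left = bound′ σ ∷ left σ
      ; right = right′ σ
      ; bound = bound′ σ
      ; left≤ = ≤-reflexive (bits-at _ _)
      ; right≤ = ≤-trans (≤-reflexive (bits-at _ _)) (<⇒≤ (middle<bound′ σ))
      ; from≤ = m≤n⊔m (suc (middle σ)) (from (right′ σ))
      }

    state : ℕ → State
    state zero = record
      { left = [] ; right = [] ; bound = from [] ; left≤ = root≤ ; right≤ = root≤ ; from≤ = ≤-refl }
    state (suc k) = advance (state k)

    run-left = branch (λ k → left (state k)) λ k → let σ = state k in
      at-⊑ (bound′ σ) (left σ) (≤-<-trans (left≤ σ) (<-trans (bound<middle σ) (middle<bound′ σ)))

    run-right = branch (λ k → right (state k)) λ k → let σ = state k in
      at-⊑ (middle σ) (right σ) (≤-<-trans (right≤ σ) (bound<middle σ))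

    k≤bound : ∀ k → k ≤ bound (state k)
    k≤bound zero = z≤n
    k≤bound (suc k) =
      ≤-trans (s≤s (k≤bound k)) (<-trans (bound<middle (state k)) (middle<bound′ (state k)))

    covered : ∀ {j} n → j < bound (state n) → j ∈ B → from [] ≤ j → j ∈ proj₁ run-left ∪ proj₁ run-right
    covered zero j<b _ b≤j = contradiction b≤j (<⇒≱ j<b)
    covered {j} (suc n) j<b′ j∈B from≤j with j <? bound (state n) | j <? middle (state n)
    ... | yes j<b | _ = covered n j<b j∈B from≤j
    ... | no j≮b | yes j<m = inj₂ (Equivalence.to
      (proj₂ (proj₂ run-right) (suc n) j (subst (j <_) (sym (bits-at _ _)) j<m))
      (from-⊆ (middle σ) (right σ) j j∈B (≤-trans (from≤ σ) (≮⇒≥ j≮b))))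
      where σ = state n
    ... | no _ | no j≮m = inj₁ (Equivalence.to
      (proj₂ (proj₂ run-left) (suc n) j (subst (j <_) (sym (bits-at _ _)) j<b′))
      (from-⊆ (bound′ σ) (left σ) j j∈B
        (≤-trans (m≤n⊔m (suc (bound σ)) (from (left σ))) (≮⇒≥ j≮m))))
      where σ = state n

    meets-ideal : B ∈ I
    meets-ideal = ⊆-closed
      (λ {j} j∈B → case j <? from [] of λ where
        (yes j<b) → inj₁ j<b
        (no j≮b) → inj₂ (covered (suc j) (k≤bound (suc j)) j∈B (≮⇒≥ j≮b)))
      (∪-closed (finite∈ (bounded⇒finite (from [] , λ _ → id)))
        (∪-closed (proj₁ (proj₂ run-left)) (proj₁ (proj₂ run-right))))

  module _ {S : Family ℕ} (analytic : Analytic S) {𝒰 : Family ℕ} where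
    open Analytic analytic

    Position : Set₁
    Position = Σ[ N ∈ Node ] Inseparable analytic 𝒰 N

    answer : Position → 𝒫 ℕ
    answer (N , insep) = proj₁ (fork analytic 𝒰 N insep)

    answer-fork : (P : Position) → Fork analytic 𝒰 (proj₁ P) (answer P)
    answer-fork (N , insep) = proj₂ (fork analytic 𝒰 N insep)

    move : ℕ → Position → Position
    move m P =
      node (answer P) m (proj₁ (forks m)) (suc (depth (proj₁ P))) , proj₂ (proj₂ (forks m))
      where forks = proj₂ (proj₂ (answer-fork P))

    move-⊑ : ∀ {m} P → bits (proj₁ P) < m → proj₁ P ⊑ proj₁ (move m P)
    move-⊑ {m} P b<m = record
      { bits< = b<m
      ; approx~ = proj₁ (proj₂ (answer-fork P))
      ; depth< = ≤-refl
      ; path~ = proj₁ (proj₂ (proj₂ (proj₂ (answer-fork P)) m))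
      }

    position : ¬ FσSeparated S 𝒰 → List ℕ → Position
    position insep [] = node U 0 (λ _ → 0) 0 , λ sep → insep (separated-⊆
      (λ A A∈S → let y , A,y∈ = complete A∈S in (λ _ ()) , y , (λ _ ()) , A,y∈) sep)
    position insep (m ∷ ms) = move m (position insep ms)

  ideal-separated : ∀ {I 𝒰} → IsIdeal I → Analytic I → PPoint 𝒰 → (∀ A → A ∈ I → A ∉ 𝒰) → FσSeparated I 𝒰
  ideal-separated {I} {𝒰} isI analytic pp I∩𝒰 = dne λ insep →
    let
      pos : List ℕ → Position analytic
      pos = position analytic insep
      at : List ℕ → Node
      at ms = proj₁ (pos ms)
      B , B∈𝒰 , almost = pseudo-intersection pp (list-code ℕ-code) (λ ms → answer analytic (pos ms))
        (λ ms → proj₁ (answer-fork analytic (pos ms)))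
    in I∩𝒰 B (Interleaving.meets-ideal isI at (λ _ _ → refl) refl
         (λ m ms → move-⊑ analytic (pos ms))
         (λ p step → branch-limit analytic (λ k → at (p k)) step
           λ k → inseparable⇒nonempty analytic 𝒰 (proj₂ (pos (p k))))
         (λ ms → proj₁ (almost ms))
         (λ m ms k k∈B from≤k → dne λ k∉ → <⇒≱ (proj₂ (almost ms) k (k∈B , k∉)) from≤k)) B∈𝒰

  -- Fσ ideals

  module _ (F : ℕ → Family ℕ) where

    Covered : List ℕ → Family ℕ
    Covered [] A = ∀ k → k ∉ A
    Covered (n ∷ ns) A = ⌊ Σ[ C ∈ 𝒫 ℕ ] C ∈ F n × A ∖ C ∈ Covered ns ⌋

    covered-⊆ : ∀ ns {A B} → A ⊆ B → B ∈ Covered ns → A ∈ Covered ns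
    covered-⊆ [] A⊆B B-empty k k∈A = B-empty k (A⊆B k∈A)
    covered-⊆ (n ∷ ns) A⊆B B-cov =
      let C , C∈F , B∖C = unshrink B-cov in
      shrink (C , C∈F , covered-⊆ ns (map₁ A⊆B) B∖C)

    covered-∪ : ∀ ns ms {A B} → A ∈ Covered ns → B ∈ Covered ms → A ∪ B ∈ Covered (ns ++ ms)
    covered-∪ [] ms A-empty B-cov =
      covered-⊆ ms (λ {k} → [ (λ k∈A → contradiction k∈A (A-empty k)) , id ]′) B-cov
    covered-∪ (n ∷ ns) ms A-cov B-cov =
      let C , C∈F , A∖C = unshrink A-cov in
      shrink (C , C∈F , covered-⊆ (ns ++ ms)
        (λ { (inj₁ k∈A , k∉C) → inj₁ (k∈A , k∉C) ; (inj₂ k∈B , _) → inj₂ k∈B })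
        (covered-∪ ns ms A∖C B-cov))

    covered-closed : (∀ n → Closed (F n)) → ∀ ns → Closed (Covered ns)
    covered-closed closed [] = limit⇒closed λ A lim k k∈A →
      let B , A~B , B-empty = lim (suc k) in B-empty k (Equivalence.to (A~B k ≤-refl) k∈A)
    covered-closed closed (n ∷ ns) = limit⇒closed λ A lim →
      let
        witness : ∀ m → Σ[ C ∈ 𝒫 ℕ ] C ∈ F n × proj₁ (lim m) ∖ C ∈ Covered ns
        witness m = unshrink (proj₂ (proj₂ (lim m)))
        C , C-cluster = cluster-point (λ m → proj₁ (witness m))
      in shrink (C
        , closed⇒limit (closed n) C (λ m →
            let j , m≤j , C~Cj = C-cluster m in
            proj₁ (witness j) , C~Cj , proj₁ (proj₂ (witness j)))
        , closed⇒limit (covered-closed closed ns) (A ∖ C) λ m →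
            let j , m≤j , C~Cj = C-cluster m in
            proj₁ (lim j) ∖ proj₁ (witness j) ,
            agree-∖ (agree-≤ m≤j (proj₁ (proj₂ (lim j)))) C~Cj , proj₂ (proj₂ (witness j)))

  separated⇒extendable : ∀ {I 𝒰} → IsIdeal I → IsUltrafilter 𝒰 → FσSeparated I 𝒰 → FσExtendable I
  separated⇒extendable {I} {𝒰} isI isU (F , closed , away , cover) =
    J ,
    record
      { finite∈ = λ fin → I⊆J (IsIdeal.finite∈ isI fin)
      ; ⊆-closed = λ A⊆B (ns , B-cov) → ns , covered-⊆ F ns A⊆B B-cov
      ; ∪-closed = λ (ns , A-cov) (ms , B-cov) → ns ++ ms , covered-∪ F ns ms A-cov B-cov
      ; proper = λ (ns , cov) → J∩𝒰 ns cov (cofinite∈ (Finite-⊆ (λ k∉U → k∉U _) Finite-∅))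
      } ,
    (reindex (list-code ℕ-code) (Covered F) ,
      reindex-closed (list-code ℕ-code) (Covered F) (covered-closed F closed) ,
      (λ (ns , cov) → _ , ns , refl , cov) , λ (_ , ns , _ , cov) → ns , cov) ,
    I⊆J
    where
      open Ultra isU
      J : Family ℕ
      J A = ∃[ ns ] A ∈ Covered F ns
      I⊆J : I ⊆ J
      I⊆J {A} A∈I with n , A∈F ← cover A A∈I = n ∷ [] , shrink (A , A∈F , λ _ (k∈A , k∉A) → k∉A k∈A)
      J∩𝒰 : ∀ ns {A} → A ∈ Covered F ns → A ∉ 𝒰
      J∩𝒰 [] empty A∈𝒰 = let k , k∈A , _ = disjoint A∈𝒰 A∈𝒰 in empty k k∈A
      J∩𝒰 (n ∷ ns) A-cov A∈𝒰 =
        let C , C∈F , A∖C = unshrink A-cov in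
        J∩𝒰 ns A∖C (∩-closed A∈𝒰 (∁∉ (away n C C∈F)))

  pushforward-PPoint : ∀ {𝒰} (f : ℕ → ℕ) → PPoint 𝒰 → (∀ A → Finite A → f ⊢ A ∉ 𝒰) →
    PPoint (λ A → f ⊢ A ∈ 𝒰)
  pushforward-PPoint {𝒰} f (isU , pp) free =
    record
      { cofinite∈ = λ fin → dne λ A∉ → free _ fin (∁∉ A∉)
      ; ⊆-closed = λ A⊆B → ⊆-closed A⊆B
      ; ∩-closed = ∩-closed
      ; proper = proper
      ; ultra = λ A → ultra (f ⊢ A)
      } , λ 𝒜 (e , enum) 𝒜⊆ →
        let
          𝒜′ : Family ℕ
          𝒜′ D = ⌊ Σ[ A ∈ 𝒫 ℕ ] A ∈ 𝒜 × D ≐ f ⊢ A ⌋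
          B , B∈𝒰 , fin = pp 𝒜′
            ((λ n → f ⊢ e n) , λ D D∈ →
              let A , A∈𝒜 , D⊆ , ⊆D = unshrink D∈
                  n , A⊆e , e⊆A = enum A A∈𝒜
              in n , (λ d → A⊆e (D⊆ d)) , λ d → ⊆D (e⊆A d))
            (λ D∈ → let A , A∈𝒜 , D⊆ , _ = unshrink D∈ in
              ⊆-closed (λ k∉A k∈D → k∉A (D⊆ k∈D)) (𝒜⊆ A∈𝒜))
        in (λ j → ∃[ k ] k ∈ B × f k ≡ j) , ⊆-closed (λ {k} k∈B → k , k∈B , refl) B∈𝒰 , λ A A∈𝒜 →
           Finite-⊆ (λ { (j∈A , k , k∈B , refl) → k , (j∈A , k∈B) , refl })
             (Finite-image f (fin (f ⊢ A) (shrink (A , A∈𝒜 , (λ {_} d → d) , λ {_} d → d))))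
    where open Ultra isU

  PPoint⇒I-ultrafilter : ∀ {I 𝒰} → IsIdeal I → Borel I → ¬ FσExtendable I → PPoint 𝒰 → I -ultrafilter 𝒰
  PPoint⇒I-ultrafilter {I} {𝒰} isI borel ¬ext pp = proj₁ pp , λ (f , red) →
    let avoids = λ A A∈I → ∁∈ {f ⊢ A} (red A A∈I)
        image = pushforward-PPoint f pp λ A fin → avoids A (IsIdeal.finite∈ isI fin)
    in ¬ext (separated⇒extendable isI (proj₁ image)
         (ideal-separated isI (proj₁ (borel⇒analytic borel)) image avoids))
    where open Ultra (proj₁ pp)

  -- Well-ordering and the continuum hypothesis

  module Zermelo (X : Set) (x₀ : X) where

    private
      Subset : Set
      Subset = X → Bool

    infix 4 _⊆ᵇ_
    _⊆ᵇ_ : Subset → Subset → Set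
    R ⊆ᵇ S = ∀ x → T (R x) → T (S x)

    ⊆ᵇ-antisym : ∀ {R S} → R ⊆ᵇ S → S ⊆ᵇ R → R ≡ S
    ⊆ᵇ-antisym = Bool-ext ext

    comprehension : (X → Set) → Subset
    comprehension P x = isYes (em {P = P x})

    choose : Subset → X
    choose S with em {P = ∃[ x ] ¬ T (S x)}
    ... | yes (x , _) = x
    ... | no _ = x₀

    choose∉ : ∀ (S : Subset) {x} → ¬ T (S x) → ¬ T (S (choose S))
    choose∉ S x∉S with em {P = ∃[ x ] ¬ T (S x)}
    ... | yes (_ , y∉S) = y∉S
    ... | no ∄ = contradiction (_ , x∉S) ∄

    step : Subset → Subset
    step S = comprehension λ x → T (S x) ⊎ x ≡ choose S

    ⊆ᵇ-step : ∀ S → S ⊆ᵇ step S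
    ⊆ᵇ-step S x x∈S = shrink (inj₁ x∈S)

    choose∈step : ∀ S → T (step S (choose S))
    choose∈step S = shrink (inj₂ refl)

    union-of : (Subset → Bool) → Subset
    union-of P = comprehension λ x → ∃[ S ] T (P S) × T (S x)

    data Tower : Subset → Set where
      step-tower : ∀ {S} → Tower S → Tower (step S)
      union-tower : ∀ P → (∀ S → T (P S) → Tower S) → Tower (union-of P)

    Extreme : Subset → Set
    Extreme S = ∀ {R} → Tower R → R ⊆ᵇ S → ¬ S ⊆ᵇ R → step R ⊆ᵇ S

    compare-extreme : ∀ {R S} → Extreme S → Tower R → R ⊆ᵇ S ⊎ step S ⊆ᵇ R
    compare-extreme {S = S} ex (step-tower {R} t) with compare-extreme ex t
    ... | inj₂ S⁺⊆ᵇR = inj₂ λ x x∈ → ⊆ᵇ-step R x (S⁺⊆ᵇR x x∈)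
    ... | inj₁ R⊆ᵇS with em {P = S ⊆ᵇ R}
    ... | no S⋢R = inj₁ (ex t R⊆ᵇS S⋢R)
    ... | yes S⊆ᵇR with refl ← ⊆ᵇ-antisym R⊆ᵇS S⊆ᵇR = inj₂ λ _ → id
    compare-extreme {S = S} ex (union-tower P t) with em {P = ∀ Q → T (P Q) → Q ⊆ᵇ S}
    ... | yes all⊆ᵇS = inj₁ λ x x∈ → let Q , Q∈P , x∈Q = unshrink x∈ in all⊆ᵇS Q Q∈P x x∈Q
    ... | no ¬all with Q , ¬imp ← ¬∀⇒∃¬ ¬all with Q∈P , Q⋢S ← ¬→⇒×¬ ¬imp
                  with compare-extreme ex (t Q Q∈P)
    ... | inj₁ Q⊆ᵇS = contradiction Q⊆ᵇS Q⋢S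
    ... | inj₂ S⁺⊆ᵇQ = inj₂ λ x x∈ → shrink (Q , Q∈P , S⁺⊆ᵇQ x x∈)

    extreme : ∀ {S} → Tower S → Extreme S
    extreme (step-tower {S} tS) {R} tR R⊆ᵇS⁺ S⁺⋢R with compare-extreme (extreme tS) tR
    ... | inj₂ S⁺⊆ᵇR = contradiction S⁺⊆ᵇR S⁺⋢R
    ... | inj₁ R⊆ᵇS with em {P = S ⊆ᵇ R}
    ... | no S⋢R = λ x x∈ → ⊆ᵇ-step S x (extreme tS tR R⊆ᵇS S⋢R x x∈)
    ... | yes S⊆ᵇR with refl ← ⊆ᵇ-antisym R⊆ᵇS S⊆ᵇR = λ _ → id
    extreme (union-tower P t) {R} tR R⊆ᵇ⋃ ⋃⋢R with em {P = ∀ Q → T (P Q) → Q ⊆ᵇ R}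
    ... | yes all⊆ᵇR =
      ⊥-elim (⋃⋢R λ x x∈ → let Q , Q∈P , x∈Q = unshrink x∈ in all⊆ᵇR Q Q∈P x x∈Q)
    ... | no ¬all with Q , ¬imp ← ¬∀⇒∃¬ ¬all with Q∈P , Q⋢R ← ¬→⇒×¬ ¬imp
                  with compare-extreme (extreme (t Q Q∈P)) tR
    ... | inj₂ Q⁺⊆ᵇR = contradiction (λ x x∈Q → Q⁺⊆ᵇR x (⊆ᵇ-step Q x x∈Q)) Q⋢R
    ... | inj₁ R⊆ᵇQ = λ x x∈ → shrink (Q , Q∈P , extreme (t Q Q∈P) tR R⊆ᵇQ Q⋢R x x∈)

    compare : ∀ {R S} → Tower R → Tower S → R ⊆ᵇ S ⊎ step S ⊆ᵇ R
    compare tR tS = compare-extreme (extreme tS) tR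

    largest-with : (Subset → Set) → Subset
    largest-with P = union-of λ S → isYes (em {P = Tower S × P S})

    largest-tower : ∀ P → Tower (largest-with P)
    largest-tower P = union-tower _ λ S S∈ → proj₁ (unshrink S∈)

    ⊆ᵇ-largest : ∀ P {S} → Tower S → P S → S ⊆ᵇ largest-with P
    ⊆ᵇ-largest P tS pS x x∈S = shrink (_ , shrink (tS , pS) , x∈S)

    segment : X → Subset
    segment x = largest-with λ S → ¬ T (S x)

    infix 4 _≺_
    _≺_ : X → X → Set
    y ≺ x = T (segment x y)

    segment-irrefl : ∀ x → ¬ x ≺ x
    segment-irrefl x x∈ = let S , S∈ , x∈S = unshrink x∈ in proj₂ (unshrink S∈) x∈S

    step-adds : ∀ (S : Subset) {x} → T (step S x) → ¬ T (S x) → x ≡ choose S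
    step-adds S x∈ x∉S = [ (λ x∈S → contradiction x∈S x∉S) , id ]′ (unshrink x∈)

    choose-segment : ∀ x → choose (segment x) ≡ x
    choose-segment x with em {P = T (step (segment x) x)}
    ... | yes x∈ = sym (step-adds (segment x) x∈ (segment-irrefl x))
    ... | no x∉ = contradiction
      (⊆ᵇ-largest (λ S → ¬ T (S x)) (step-tower (largest-tower _)) x∉
        (choose (segment x)) (choose∈step (segment x)))
      (choose∉ (segment x) (segment-irrefl x))

    step-segment : ∀ {x S} → step (segment x) ⊆ᵇ S → T (S x)
    step-segment {x} {S} inc = inc x
      (subst (λ y → T (step (segment x) y)) (choose-segment x) (choose∈step (segment x)))

    ≺-tri : ∀ x y → x ≺ y ⊎ x ≡ y ⊎ y ≺ x
    ≺-tri x y with compare {segment y} {segment x} (largest-tower _) (largest-tower _)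
                 | compare {segment x} {segment y} (largest-tower _) (largest-tower _)
    ... | inj₂ inc | _ = inj₁ (step-segment {x} {segment y} inc)
    ... | inj₁ _ | inj₂ inc = inj₂ (inj₂ (step-segment {y} {segment x} inc))
    ... | inj₁ y⊆ᵇx | inj₁ x⊆ᵇy = inj₂ (inj₁
      (trans (sym (choose-segment x)) (trans (cong choose (⊆ᵇ-antisym x⊆ᵇy y⊆ᵇx)) (choose-segment y))))

    minimum : (A : X → Set) → ∃[ x ] A x → ∃[ m ] A m × (∀ a → A a → ¬ a ≺ m)
    minimum A (a₀ , a₀∈A) = m , m∈A , λ a a∈A a≺m →
      case compare {segment m} {S} (largest-tower _) (largest-tower _) of λ where
        (inj₁ seg⊆ᵇS) → S-avoids a (seg⊆ᵇS a a≺m) a∈A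
        (inj₂ S⁺⊆ᵇseg) → segment-irrefl m (S⁺⊆ᵇseg m (choose∈step S))
      where
        Avoids : Subset → Set
        Avoids S = ∀ x → T (S x) → ¬ A x
        S = largest-with Avoids
        m = choose S
        S-avoids : Avoids S
        S-avoids x x∈S = let R , R∈ , x∈R = unshrink x∈S in proj₂ (unshrink R∈) x x∈R
        m∈A : A m
        m∈A = dne λ m∉A → choose∉ S (λ a₀∈S → S-avoids a₀ a₀∈S a₀∈A)
          (⊆ᵇ-largest Avoids (step-tower (largest-tower Avoids))
            (λ x x∈ → [ S-avoids x , (λ { refl → m∉A }) ]′ (unshrink x∈)) m (choose∈step S))

    ≺-wellFounded : WellFounded _≺_
    ≺-wellFounded x = dne λ ¬acc →
      let m , ¬acc-m , least = minimum (λ y → ¬ Acc _≺_ y) (x , ¬acc) in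
      ¬acc-m (acc λ {y} y≺m → dne λ ¬acc-y → least y ¬acc-y y≺m)

  Real : Set
  Real = ℕ → Bool

  ⟦_⟧ : Real → 𝒫 ℕ
  ⟦ x ⟧ k = T (x k)

  module WO = Zermelo Real (λ _ → false)

  χ : 𝒫 ℕ → Real
  χ A k = isYes (em {P = k ∈ A})

  χ-⊆ : ∀ {A x} → A ⊆ ⟦ x ⟧ → ⟦ x ⟧ ⊆ A → χ A ≡ x
  χ-⊆ A⊆x x⊆A = Bool-ext ext (λ k k∈ → A⊆x (unshrink k∈)) (λ k k∈x → shrink (x⊆A k∈x))

  χ-≡ : ∀ {A B} → χ A ≡ χ B → A ⊆ B
  χ-≡ eq {k} k∈A = unshrink (subst (λ x → T (x k)) eq (shrink k∈A))

  CH⇒Ω₁Order : ContinuumHypothesis → Ω₁Order Real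
  CH⇒Ω₁Order ch with em {P = ∃[ x ] ¬ ⌊ Countable (λ A → χ A WO.≺ x) ⌋}
  ... | no ∄ = record
    { _≺_ = WO._≺_
    ; wellFounded = WO.≺-wellFounded
    ; trichotomy = WO.≺-tri
    ; countable = λ x → let e , enum = unshrink (dne λ ¬count → ∄ (x , ¬count)) in
        (λ n → χ (e n)) , λ y y≺x →
          let n , y⊆ , ⊆y = enum ⟦ y ⟧ (subst (WO._≺ x) (sym (χ-⊆ {x = y} id id)) y≺x)
          in n , χ-⊆ ⊆y y⊆
    }
  ... | yes uncountable = record
    { _≺_ = λ y z → g y WO.≺ g z
    ; wellFounded = On.wellFounded g WO.≺-wellFounded
    ; trichotomy = λ y z → map-⊎ id (map-⊎ g-injective id) (WO.≺-tri (g y) (g z))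
    ; countable = λ z →
        let e , enum = unshrink (dne λ ¬count → below-m-countable (g z) ¬count (f∈ ⟦ z ⟧))
        in inverse ∘ e , λ y gy≺gz → let n , fy≐e = enum (f ⟦ y ⟧) gy≺gz in n , inverse-f fy≐e
    }
    where
      m = proj₁ (WO.minimum _ uncountable)
      m-uncountable = proj₁ (proj₂ (WO.minimum _ uncountable))
      below-m-countable = proj₂ (proj₂ (WO.minimum _ uncountable))

      copy : Σ[ f ∈ (𝒫 ℕ → 𝒫 ℕ) ] (∀ {A B} → f A ≐ f B → A ≐ B) × (∀ A → χ (f A) WO.≺ m)
      copy with ch (λ A → χ A WO.≺ m)
      ... | inj₁ count = contradiction (shrink count) m-uncountable
      ... | inj₂ (f , _ , inj , f∈) = f , inj , f∈

      f = proj₁ copy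
      f∈ = proj₂ (proj₂ copy)

      g : Real → Real
      g x = χ (f ⟦ x ⟧)

      f-injective : ∀ {y z} → f ⟦ y ⟧ ≐ f ⟦ z ⟧ → y ≡ z
      f-injective fy≐fz with y⊆z , z⊆y ← proj₁ (proj₂ copy) fy≐fz =
        Bool-ext ext (λ k → y⊆z) (λ k → z⊆y)

      g-injective : ∀ {y z} → g y ≡ g z → y ≡ z
      g-injective eq = f-injective (χ-≡ eq , χ-≡ (sym eq))

      inverse : 𝒫 ℕ → Real
      inverse A with em {P = ∃[ y ] f ⟦ y ⟧ ≐ A}
      ... | yes (y , _) = y
      ... | no _ = λ _ → false

      inverse-f : ∀ {y A} → f ⟦ y ⟧ ≐ A → inverse A ≡ y
      inverse-f {y} {A} fy≐A with em {P = ∃[ z ] f ⟦ z ⟧ ≐ A}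
      ... | yes (_ , fz≐A) = f-injective (≐-trans fz≐A (≐-sym fy≐A))
      ... | no ∄ = contradiction (y , fy≐A) ∄

  module _ {X : Set} (order : Ω₁Order X) where
    open Ω₁Order order

    -- Each value is picked below all earlier ones whenever that is possible; it always is,
    -- because the earlier values form a countable chain.
    generic-chain : ∀ {q d} {Q : Set q} (_≤Q_ : Q → Q → Set) →
      (∀ {p} → p ≤Q p) → (∀ {p q r} → p ≤Q q → q ≤Q r → p ≤Q r) →
      (top : Q) → (∀ q → q ≤Q top) →
      ((q : ℕ → Q) → (∀ n → q (suc n) ≤Q q n) → Σ[ r ∈ Q ] (∀ n → r ≤Q q n)) →
      (D : X → Q → Set d) → (∀ x q → Σ[ r ∈ Q ] r ≤Q q × D x r) →
      Σ[ G ∈ (X → Q) ] (∀ {x y} → y ≺ x → G x ≤Q G y) × (∀ x → D x (G x))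
    generic-chain {Q = Q} _≤Q_ ≤-refl′ ≤-trans′ top ≤top σ-closed D dense =
      G , (λ y≺x → proj₂ (G-good _) _ y≺x) , λ x → proj₁ (G-good x)
      where
        Good : ∀ x → WfRec _≺_ (λ _ → Q) x → Q → Set _
        Good x IH r = D x r × (∀ y (y≺x : y ≺ x) → r ≤Q IH y≺x)

        pick : ∀ x → WfRec _≺_ (λ _ → Q) x → Q
        pick x IH with em {P = Σ[ r ∈ Q ] Good x IH r}
        ... | yes (r , _) = r
        ... | no _ = top

        pick-good : ∀ x (IH : WfRec _≺_ (λ _ → Q) x) → Σ[ r ∈ Q ] Good x IH r → Good x IH (pick x IH)
        pick-good x IH r-good with em {P = Σ[ r ∈ Q ] Good x IH r}
        ... | yes (_ , good) = good
        ... | no ∄ = contradiction r-good ∄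

        G : X → Q
        G = All.wfRec wellFounded _ (λ _ → Q) pick

        G-unfold : ∀ x → G x ≡ pick x (λ {y} _ → G y)
        G-unfold x = FixPoint.unfold-wfRec wellFounded (λ _ → Q) pick
          (λ x {IH} {IH′} eq → cong (λ (h : WfRec _≺_ (λ _ → Q) x) → pick x h)
            (implicit-extensionality ext (ext eq))) {x}

        Earlier : X → Set _
        Earlier x = D x (G x) × (∀ y → y ≺ x → G x ≤Q G y)

        module _ (x : X) (IH : ∀ {y} → y ≺ x → Earlier y) where
          e = proj₁ (countable x)

          extend : ℕ → Q → Q
          extend n q with em {P = e n ≺ x × G (e n) ≤Q q}
          ... | yes _ = G (e n)
          ... | no _ = q

          descending : ℕ → Q
          descending zero = top
          descending (suc n) = extend n (descending n)

          descends : ∀ n → descending (suc n) ≤Q descending n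
          descends n with em {P = e n ≺ x × G (e n) ≤Q descending n}
          ... | yes (_ , G≤) = G≤
          ... | no _ = ≤-refl′

          Comparable : Q → Set
          Comparable q = ∀ y → y ≺ x → q ≤Q G y ⊎ G y ≤Q q

          comparable : ∀ n → Comparable (descending n)
          comparable zero y _ = inj₂ (≤top _)
          comparable (suc n) y y≺x with em {P = e n ≺ x × G (e n) ≤Q descending n}
          ... | no _ = comparable n y y≺x
          ... | yes (en≺x , _) with trichotomy y (e n)
          ... | inj₁ y≺en = inj₁ (proj₂ (IH en≺x) y y≺en)
          ... | inj₂ (inj₁ refl) = inj₁ ≤-refl′
          ... | inj₂ (inj₂ en≺y) = inj₂ (proj₂ (IH y≺x) (e n) en≺y)

          cofinal : ∀ n → e n ≺ x → descending (suc n) ≤Q G (e n)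
          cofinal n en≺x with em {P = e n ≺ x × G (e n) ≤Q descending n}
          ... | yes _ = ≤-refl′
          ... | no ¬both = [ id , (λ G≤ → contradiction (en≺x , G≤) ¬both) ]′ (comparable n (e n) en≺x)

          good-exists : Σ[ r ∈ Q ] Good x (λ {y} _ → G y) r
          good-exists =
            let b , b≤ = σ-closed descending descends
                r , r≤b , r∈D = dense x b
            in r , r∈D , λ y y≺x →
              let n , en≡y = proj₂ (countable x) y y≺x in
              subst (λ z → r ≤Q G z) en≡y
                (≤-trans′ r≤b (≤-trans′ (b≤ (suc n)) (cofinal n (subst (_≺ x) (sym en≡y) y≺x))))

        G-good : ∀ x → Earlier x
        G-good = All.wfRec wellFounded _ Earlier λ x IH →
          subst (λ q → D x q × (∀ y → y ≺ x → q ≤Q G y)) (sym (G-unfold x))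
            (pick-good x (λ {y} _ → G y) (good-exists x IH))

  -- Ultrafilters generated by towers of positive sets

  module _ {K J : Family ℕ} (isK : IsIdeal K) (isJ : IsIdeal J) where
    private
      module K = IsIdeal isK
      module J = IsIdeal isJ

    σ-Closed : Set₁
    σ-Closed = (E : ℕ → 𝒫 ℕ) → (∀ n → E (suc n) ⊆ E n) → (∀ n → E n ∉ J) →
      Σ[ A ∈ 𝒫 ℕ ] A ∉ J × (∀ n → A ∖ E n ∈ K)

    generic-ultrafilter : Ω₁Order Real → K ⊆ J → σ-Closed →
      (D : Real → Pred (𝒫 ℕ) ℓ) → (∀ x A → A ∉ J → Σ[ B ∈ 𝒫 ℕ ] B ⊆ A × B ∉ J × B ∈ D x) →
      Σ[ 𝒰 ∈ Family ℕ ] IsUltrafilter 𝒰 × (∀ A → A ∈ J → A ∉ 𝒰) × (∀ x → Σ[ A ∈ 𝒫 ℕ ] A ∈ 𝒰 × A ∈ D x)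
    generic-ultrafilter order K⊆J σ-closed D dense =
      𝒰 ,
      record
        { cofinite∈ = λ fin → (λ _ → false) , K.⊆-closed proj₂ (K.finite∈ fin)
        ; ⊆-closed = λ A⊆B (x , G∖A) → x , K.⊆-closed (map₂ λ k∉B k∈A → k∉B (A⊆B k∈A)) G∖A
        ; ∩-closed = λ {A} {B} (x , Gx∖A) (y , Gy∖B) →
            let z , Gz≤Gx , Gz≤Gy = directed x y in
            z , K.⊆-closed (∖-∩ A B (proj₁ (G z)))
              (K.∪-closed (≤-below {G z} {G x} Gz≤Gx Gx∖A) (≤-below {G z} {G y} Gz≤Gy Gy∖B))
        ; proper = λ (x , G∖∅) → positive (G x) (K⊆J (K.⊆-closed (λ k∈ → k∈ , λ ()) G∖∅))
        ; ultra = λ A → map-⊎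
            (λ G⊆A → χ A , difference∈K λ k∈ → unshrink (G⊆A k∈))
            (λ G∩A → χ A , difference∈K λ k∈ k∈A → G∩A k∈ (shrink k∈A))
            (proj₂ (proj₂ (proj₂ chain) (χ A)))
        } ,
      (λ A A∈J (x , G∖A) → positive (G x)
        (J.⊆-closed (split (proj₁ (G x)) A) (J.∪-closed A∈J (K⊆J G∖A)))) ,
      λ x → proj₁ (G x) , (x , difference∈K id) , proj₁ (proj₂ (proj₂ chain) x)
      where
        Q : Set₁
        Q = Σ[ A ∈ 𝒫 ℕ ] A ∉ J

        _≤Q_ : Q → Q → Set
        (A , _) ≤Q (B , _) = A ∖ B ∈ K

        difference∈K : ∀ {A B : 𝒫 ℕ} → A ⊆ B → A ∖ B ∈ K
        difference∈K A⊆B = K.finite∈ (Finite-⊆ (λ (k∈A , k∉B) → contradiction (A⊆B k∈A) k∉B) Finite-∅)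

        split : ∀ (A B : 𝒫 ℕ) → A ⊆ B ∪ (A ∖ B)
        split A B {k} k∈A with em {P = k ∈ B}
        ... | yes k∈B = inj₁ k∈B
        ... | no k∉B = inj₂ (k∈A , k∉B)

        ∖-∩ : ∀ (A B C : 𝒫 ℕ) → C ∖ (A ∩ B) ⊆ (C ∖ A) ∪ (C ∖ B)
        ∖-∩ A B C {k} (k∈C , k∉A∩B) with em {P = k ∈ A}
        ... | no k∉A = inj₁ (k∈C , k∉A)
        ... | yes k∈A = inj₂ (k∈C , λ k∈B → k∉A∩B (k∈A , k∈B))

        ∖-trans : ∀ {A} B {C : 𝒫 ℕ} → A ∖ B ∈ K → B ∖ C ∈ K → A ∖ C ∈ K
        ∖-trans {A} B A∖B B∖C = K.⊆-closed
          (λ (k∈A , k∉C) → [ (λ k∈B → inj₂ (k∈B , k∉C)) , inj₁ ]′ (split A B k∈A))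
          (K.∪-closed A∖B B∖C)

        ≤-below : ∀ {p q : Q} {A : 𝒫 ℕ} → p ≤Q q → proj₁ q ∖ A ∈ K → proj₁ p ∖ A ∈ K
        ≤-below {q = q} = ∖-trans (proj₁ q)

        positive : ∀ (q : Q) → proj₁ q ∉ J
        positive = proj₂

        lower-bound : (q : ℕ → Q) → (∀ n → q (suc n) ≤Q q n) → Σ[ r ∈ Q ] (∀ n → r ≤Q q n)
        lower-bound q desc =
          let A , A∉J , A∖E = σ-closed E (λ _ → proj₁)
                (λ n E∈J → positive (q n)
                  (J.⊆-closed (split (proj₁ (q n)) (E n)) (J.∪-closed E∈J (K⊆J (q∖E n)))))
          in (A , A∉J) , λ n → K.⊆-closed (map₂ λ k∉q k∈E → k∉q (E⊆q n k∈E)) (A∖E n)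
          where
            E : ℕ → 𝒫 ℕ
            E zero = proj₁ (q zero)
            E (suc n) = E n ∩ proj₁ (q (suc n))
            E⊆q : ∀ n → E n ⊆ proj₁ (q n)
            E⊆q zero = id
            E⊆q (suc n) = proj₂
            q∖E : ∀ n → proj₁ (q n) ∖ E n ∈ K
            q∖E zero = difference∈K id
            q∖E (suc n) = K.⊆-closed
              (λ (k∈q , k∉E) → k∈q , λ k∈En → k∉E (k∈En , k∈q))
              (∖-trans (proj₁ (q n)) (desc n) (q∖E n))

        D′ : Real → Q → Set _
        D′ x (A , _) = A ∈ D x × (A ⊆ ⟦ x ⟧ ⊎ A ⊆ ∁ ⟦ x ⟧)

        decided : ∀ x A → A ∉ J → Σ[ B ∈ 𝒫 ℕ ] B ⊆ A × B ∉ J × (B ⊆ ⟦ x ⟧ ⊎ B ⊆ ∁ ⟦ x ⟧)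
        decided x A A∉J with em {P = A ∩ ⟦ x ⟧ ∈ J}
        ... | no A∩x∉J = A ∩ ⟦ x ⟧ , proj₁ , A∩x∉J , inj₁ proj₂
        ... | yes A∩x∈J = A ∖ ⟦ x ⟧ , proj₁ , (λ A∖x∈J → A∉J (J.⊆-closed
          (λ k∈A → map-⊎ (k∈A ,_) id (split A ⟦ x ⟧ k∈A)) (J.∪-closed A∩x∈J A∖x∈J))) , inj₂ proj₂

        dense′ : ∀ x q → Σ[ r ∈ Q ] r ≤Q q × D′ x r
        dense′ x (A , A∉J) =
          let B , B⊆A , B∉J , dec = decided x A A∉J
              C , C⊆B , C∉J , C∈D = dense x B B∉J
          in (C , C∉J) , difference∈K (λ k∈C → B⊆A (C⊆B k∈C)) , C∈D ,
             map-⊎ (λ B⊆x {_} k∈C → B⊆x (C⊆B k∈C)) (λ B∩x {_} k∈C → B∩x (C⊆B k∈C)) dec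

        chain = generic-chain order _≤Q_ (difference∈K id) (λ {_} {q} → ∖-trans (proj₁ q))
          (U , J.proper) (λ _ → difference∈K _) lower-bound D′ dense′

        G : Real → Q
        G = proj₁ chain

        𝒰 : Family ℕ
        𝒰 A = ∃[ x ] proj₁ (G x) ∖ A ∈ K

        directed : ∀ x y → ∃[ z ] G z ≤Q G x × G z ≤Q G y
        directed x y with Ω₁Order.trichotomy order x y
        ... | inj₁ x≺y = y , proj₁ (proj₂ chain) x≺y , difference∈K id
        ... | inj₂ (inj₁ refl) = x , difference∈K id , difference∈K id
        ... | inj₂ (inj₂ y≺x) = x , difference∈K id , proj₁ (proj₂ chain) y≺x

  slice : Real → ℕ → 𝒫 ℕ
  slice x n k = T (x (pair n k))

  code : (ℕ → 𝒫 ℕ) → Real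
  code S = χ λ a → ∃[ n ] ∃[ k ] a ≡ pair n k × k ∈ S n

  slice-code : ∀ S n k → k ∈ S n → k ∈ slice (code S) n
  slice-code S n k k∈S = shrink (n , k , refl , k∈S)

  code-slice : ∀ S n k → k ∈ slice (code S) n → k ∈ S n
  code-slice S n k k∈
    with m , l , eq , l∈S ← unshrink k∈
    with refl , refl ← pair-injective {n} {k} {m} {l} eq = l∈S

  Fin²ℕ : Family ℕ
  Fin²ℕ A = (uncurry pair ⊢ A) ∈ Fin²

  Fin²ℕ-ideal : IsIdeal Fin²ℕ
  Fin²ℕ-ideal = record
    { finite∈ = λ fin → let N , below = finite⇒bounded fin in
        columns⇒fin² 0 λ n _ → bounded⇒finite
          (N , λ k k∈ → ≤-<-trans (m≤n+m k ((n + k) * (n + k))) (below _ k∈))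
    ; ⊆-closed = λ A⊆B B∈ → let N , fin = fin²⇒columns B∈ in
        columns⇒fin² N λ n N≤n → Finite-⊆ (λ k∈ → A⊆B k∈) (fin n N≤n)
    ; ∪-closed = λ A∈ B∈ →
        let N , finA = fin²⇒columns A∈
            M , finB = fin²⇒columns B∈
        in columns⇒fin² (N ⊔ M) λ n N⊔M≤n →
             Finite-∪ (finA n (m⊔n≤o⇒m≤o N M N⊔M≤n)) (finB n (m⊔n≤o⇒n≤o N M N⊔M≤n))
    ; proper = λ U∈ → let N , fin = fin²⇒columns U∈ in ℕ-infinite (fin N ≤-refl)
    }

  infinite-column : ∀ {A} → A ∉ Fin² → ∀ N → ∃[ n ] N ≤ n × ¬ Finite (Column A n)
  infinite-column A∉ N = dne λ ∄ → A∉ (columns⇒fin² N λ n N≤n → dne λ inf → ∄ (n , N≤n , inf))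

  Fin²ℕ-σ-closed : σ-Closed Fin²ℕ-ideal Fin²ℕ-ideal
  Fin²ℕ-σ-closed E dec E∉ =
    A , (λ A∈ → let N , fin = fin²⇒columns A∈
                    _ , N≤ν , inf = column N
                in inf (Finite-⊆ (λ {k} k∈ → N , k , refl , k∈) (fin (ν N) N≤ν))) ,
    λ i → let M , ν<M = bound-values ν i in
      columns⇒fin² M λ m M≤m → Finite-⊆
        (λ { {k} ((j , l , eq , k∈E) , k∉E) → case i ≤? j of λ where
          (yes i≤j) → k∉E (decreasing-≤ dec i≤j k∈E)
          (no i≰j) → <⇒≱ (ν<M j (≰⇒> i≰j))
            (subst (M ≤_) (proj₁ (pair-injective {m} {k} {ν j} {l} eq)) M≤m) })
        Finite-∅
    where
      column : ∀ j → ∃[ n ] j ≤ n × ¬ Finite (Column (uncurry pair ⊢ E j) n)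
      column j = infinite-column (E∉ j) j
      ν : ℕ → ℕ
      ν j = proj₁ (column j)
      A : 𝒫 ℕ
      A a = ∃[ j ] ∃[ k ] a ≡ pair (ν j) k × a ∈ E j

  value : Real → ℕ → ℕ
  value x n with em {P = ∃[ k ] k ∈ slice x n}
  ... | yes (k , _) = k
  ... | no _ = 0

  value∈slice : ∀ x n {k} → k ∈ slice x n → value x n ∈ slice x n
  value∈slice x n k∈ with em {P = ∃[ k ] k ∈ slice x n}
  ... | yes (_ , v∈) = v∈
  ... | no ∄ = contradiction (_ , k∈) ∄

  graph-of : (ℕ → ℕ) → ℕ → 𝒫 ℕ
  graph-of f n k = k ≡ f n

  value-code : ∀ f n → value (code (graph-of f)) n ≡ f n
  value-code f n = code-slice (graph-of f) n _
    (value∈slice (code (graph-of f)) n (slice-code (graph-of f) n (f n) refl))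

  -- Otherwise A contains a copy of ω × ω, up to finite-to-one maps in both coordinates,
  -- along which f reduces I to Fin².
  positive-preimage : ∀ {I} → ¬ (I ≤K Fin²) → (f : ℕ → ℕ) → ∀ A → A ∉ Fin²ℕ →
    Σ[ B ∈ 𝒫 ℕ ] B ∈ I × A ∩ (f ⊢ B) ∉ Fin²ℕ
  positive-preimage {I} I≰Fin² f A A∉ = dne λ ∄ → I≰Fin²
    ( (λ (n , k) → f (pair (ν n) (κ n k)))
    , λ B B∈I →
      let N , fin = fin²⇒columns (dne λ A∩f⊢B∉ → ∄ (B , B∈I , A∩f⊢B∉)) in
      columns⇒fin² N λ n N≤n →
        let M , κ<M = finite⇒bounded (fin (ν n) (≤-trans N≤n (n≤ν n))) in
        bounded⇒finite (M , λ k f∈B → ≤-<-trans (k≤κ n k) (κ<M (κ n k) (κ∈A n k , f∈B))))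
    where
      column : ∀ n → ∃[ m ] n ≤ m × ¬ Finite (Column (uncurry pair ⊢ A) m)
      column = infinite-column A∉
      ν : ℕ → ℕ
      ν n = proj₁ (column n)
      n≤ν : ∀ n → n ≤ ν n
      n≤ν n = proj₁ (proj₂ (column n))
      entry : ∀ n k → ∃[ l ] k ≤ l × pair (ν n) l ∈ A
      entry n = infinite⇒unbounded (proj₂ (proj₂ (column n)))
      κ : ℕ → ℕ → ℕ
      κ n k = proj₁ (entry n k)
      k≤κ : ∀ n k → k ≤ κ n k
      k≤κ n k = proj₁ (proj₂ (entry n k))
      κ∈A : ∀ n k → pair (ν n) (κ n k) ∈ A
      κ∈A n k = proj₂ (proj₂ (entry n k))

  Fin²ℕ-avoiding⇒¬PPoint : ∀ {𝒰} → (∀ A → A ∈ Fin²ℕ → A ∉ 𝒰) → ¬ PPoint 𝒰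
  Fin²ℕ-avoiding⇒¬PPoint {𝒰} avoids pp =
    let
      B , B∈𝒰 , almost = pseudo-intersection pp ℕ-code (λ n → ∁ (column n)) λ n →
        ∁∉ (avoids (column n) (columns⇒fin² (suc n) λ m n<m → Finite-⊆
          (λ {k} (l , eq) → <⇒≢ n<m (sym (proj₁ (pair-injective {m} {k} {n} {l} eq)))) Finite-∅))
    in avoids B (columns⇒fin² 0 λ n _ →
         let N , below = almost n in
         bounded⇒finite (N , λ k k∈ → ≤-<-trans (m≤n+m k ((n + k) * (n + k)))
           (below (pair n k) (k∈ , λ ∉col → ∉col (k , refl))))) B∈𝒰
    where
      open Ultra (proj₁ pp)
      column : ℕ → 𝒫 ℕ
      column n a = ∃[ k ] a ≡ pair n k

  RefinesPreimage : Family ℕ → (ℕ → ℕ) → 𝒫 ℕ → Set₁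
  RefinesPreimage I f A = Σ[ B ∈ 𝒫 ℕ ] B ∈ I × A ⊆ f ⊢ B

  refines-preimages⇒≰K : ∀ {I 𝒰} → IsUltrafilter 𝒰 →
    (∀ x → Σ[ A ∈ 𝒫 ℕ ] A ∈ 𝒰 × RefinesPreimage I (value x) A) → ¬ (I ≤K 𝒰 *)
  refines-preimages⇒≰K isU meets (h , red) =
    let A , A∈𝒰 , B , B∈I , A⊆ = meets (code (graph-of h)) in
    ∁∈ (red B B∈I) (⊆-closed (λ {n} n∈A → subst B (value-code h n) (A⊆ n∈A)) A∈𝒰)
    where open Ultra isU

  I-ultrafilter-not-PPoint : ∀ {I} → Ω₁Order Real → ¬ (I ≤K Fin²) →
    Σ[ 𝒰 ∈ Family ℕ ] I -ultrafilter 𝒰 × ¬ PPoint 𝒰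
  I-ultrafilter-not-PPoint {I} order I≰Fin² = conclude
    (generic-ultrafilter Fin²ℕ-ideal Fin²ℕ-ideal order id Fin²ℕ-σ-closed
      (λ x → RefinesPreimage I (value x)) dense)
    where
      dense : ∀ x A → A ∉ Fin²ℕ → Σ[ B ∈ 𝒫 ℕ ] B ⊆ A × B ∉ Fin²ℕ × RefinesPreimage I (value x) B
      dense x A A∉ = let B , B∈I , A∩ = positive-preimage I≰Fin² (value x) A A∉ in
        A ∩ (value x ⊢ B) , proj₁ , A∩ , B , B∈I , proj₂

      conclude : Σ[ 𝒰 ∈ Family ℕ ] IsUltrafilter 𝒰 × (∀ A → A ∈ Fin²ℕ → A ∉ 𝒰) ×
        (∀ x → Σ[ A ∈ 𝒫 ℕ ] A ∈ 𝒰 × RefinesPreimage I (value x) A) → _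
      conclude (𝒰 , isU , avoids , meets) =
        𝒰 , (isU , refines-preimages⇒≰K isU meets) , Fin²ℕ-avoiding⇒¬PPoint avoids

  -- Otherwise counterexamples to all m would cluster at a member of F containing X.
  escape : ∀ {J F : Family ℕ} → IsIdeal J → Closed F → F ⊆ J → ∀ X → X ∉ J →
    ∃[ m ] (∀ C → C ∈ F → ¬ (∀ k → k < m → k ∈ X → k ∈ C))
  escape {J} {F} isJ closed F⊆J X X∉J = dne λ ∄ →
    let
      trap : ∀ m → Σ[ C ∈ 𝒫 ℕ ] C ∈ F × (∀ k → k < m → k ∈ X → k ∈ C)
      trap m = dne λ none → ∄ (m , λ C C∈F X⊆C → none (C , C∈F , X⊆C))
      C , C-cluster = cluster-point (λ m → proj₁ (trap m))
      C∈F = closed⇒limit closed C λ m →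
        let j , _ , C~Cj = C-cluster m in proj₁ (trap j) , C~Cj , proj₁ (proj₂ (trap j))
    in X∉J (IsIdeal.⊆-closed isJ
         (λ {k} k∈X → let j , k<j , C~Cj = C-cluster (suc k) in
           Equivalence.from (C~Cj k ≤-refl) (proj₂ (proj₂ (trap j)) k k<j k∈X))
         (F⊆J C∈F))

  Fσ-σ-closed : ∀ {J} (isJ : IsIdeal J) → Fσ J → σ-Closed Finite-ideal isJ
  Fσ-σ-closed {J} isJ (F , closed , J⊆F , F⊆J) E dec E∉ =
    A , (λ A∈J → let n , A∈F = J⊆F A∈J in
      proj₂ (escapes n) A A∈F λ k k<m k∈E → n , k<m , k∈E) ,
    λ i → let M , m<M = bound-values (λ n → proj₁ (escapes n)) i in
      bounded⇒finite (M , λ k ((n , k<m , k∈E) , k∉E) → case i ≤? n of λ where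
        (yes i≤n) → contradiction (decreasing-≤ dec i≤n k∈E) k∉E
        (no i≰n) → <-trans k<m (m<M n (≰⇒> i≰n)))
    where
      escapes = λ n → escape isJ (closed n) (λ C∈F → F⊆J (n , C∈F)) (E n) (E∉ n)
      A : 𝒫 ℕ
      A k = ∃[ n ] k < proj₁ (escapes n) × k ∈ E n

  Diagonal : (ℕ → 𝒫 ℕ) → 𝒫 ℕ → Set
  Diagonal S A = (∀ n → Finite (A ∖ S n)) ⊎ (∃[ n ] (∀ k → k ∈ A → k ∉ S n))

  diagonal⇒PPoint : ∀ {𝒰} → IsUltrafilter 𝒰 →
    (∀ x → Σ[ A ∈ 𝒫 ℕ ] A ∈ 𝒰 × Diagonal (slice x) A) → PPoint 𝒰
  diagonal⇒PPoint {𝒰} isU meets = isU , λ 𝒜 (e , enum) 𝒜⊆𝒰* →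
    let
      S : ℕ → 𝒫 ℕ
      S n k = ¬ (e n ∈ 𝒰 * × k ∈ e n)
      A , A∈𝒰 , diagonal = meets (code S)
      S∈𝒰 : ∀ n → S n ∈ 𝒰
      S∈𝒰 n = dne λ S∉𝒰 → S∉𝒰 (⊆-closed (λ k∉e (_ , k∈e) → k∉e k∈e)
        (dne λ e∉𝒰* → S∉𝒰 (⊆-closed (λ _ (e∈𝒰* , _) → e∉𝒰* e∈𝒰*) A∈𝒰)))
    in A , A∈𝒰 , λ D D∈𝒜 →
      let n , D⊆e , e⊆D = enum D D∈𝒜
          e∈𝒰* : e n ∈ 𝒰 *
          e∈𝒰* = *-⊆ e⊆D (𝒜⊆𝒰* D∈𝒜)
      in case diagonal of λ where
        (inj₁ almost) → Finite-⊆
          (λ {k} (k∈D , k∈A) → k∈A , λ k∈S → code-slice S n k k∈S (e∈𝒰* , D⊆e k∈D)) (almost n)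
        (inj₂ (m , apart)) →
          let k , k∈A , k∈S = disjoint A∈𝒰 (S∈𝒰 m) in
          contradiction (slice-code S m k k∈S) (apart k k∈A)
    where open Ultra isU

  module _ {J : Family ℕ} (isJ : IsIdeal J) (σ-closed : σ-Closed Finite-ideal isJ) where
    private
      module J = IsIdeal isJ

    meet : 𝒫 ℕ → (ℕ → 𝒫 ℕ) → ℕ → 𝒫 ℕ
    meet A S zero = A
    meet A S (suc n) = meet A S n ∩ S n

    diagonal-dense : ∀ S A → A ∉ J → Σ[ B ∈ 𝒫 ℕ ] B ⊆ A × B ∉ J × Diagonal S B
    diagonal-dense S A A∉J with em {P = ∀ n → meet A S n ∉ J → meet A S (suc n) ∉ J}
    ... | no ¬all with n , ¬imp ← ¬∀⇒∃¬ ¬all with E∉J , ¬¬E∩S∈J ← ¬→⇒×¬ ¬imp =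
      meet A S n ∖ S n ,
      (λ (k∈E , _) → decreasing-≤ {meet A S} (λ _ → proj₁) {j = n} z≤n k∈E) ,
      (λ E∖S∈J → ¬¬E∩S∈J λ E∩S∈J → E∉J (J.⊆-closed
        (λ {k} k∈E → case em {P = k ∈ S n} of λ where
          (yes k∈S) → inj₁ (k∈E , k∈S)
          (no k∉S) → inj₂ (k∈E , k∉S))
        (J.∪-closed E∩S∈J E∖S∈J))) ,
      inj₂ (n , λ _ → proj₂)
    ... | yes step =
      let B , B∉J , B∖E = σ-closed (meet A S) (λ _ → proj₁) positive in
      A ∩ B , proj₁ ,
      (λ A∩B∈J → B∉J (J.⊆-closed
        (λ {k} k∈B → case em {P = k ∈ A} of λ where
          (yes k∈A) → inj₁ (k∈A , k∈B)
          (no k∉A) → inj₂ (k∈B , k∉A))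
        (J.∪-closed A∩B∈J (J.finite∈ (B∖E 0))))) ,
      inj₁ λ n → Finite-⊆ (λ ((_ , k∈B) , k∉S) → k∈B , λ (_ , k∈S) → k∉S k∈S) (B∖E (suc n))
      where
        positive : ∀ n → meet A S n ∉ J
        positive zero = A∉J
        positive (suc n) = step n (positive n)

    PPoint-avoiding : Ω₁Order Real → Σ[ 𝒰 ∈ Family ℕ ] PPoint 𝒰 × (∀ A → A ∈ J → A ∉ 𝒰)
    PPoint-avoiding order = conclude
      (generic-ultrafilter Finite-ideal isJ order J.finite∈ σ-closed
        (λ x → Diagonal (slice x)) (λ x → diagonal-dense (slice x)))
      where
        conclude : Σ[ 𝒰 ∈ Family ℕ ] IsUltrafilter 𝒰 × (∀ A → A ∈ J → A ∉ 𝒰) ×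
          (∀ x → Σ[ A ∈ 𝒫 ℕ ] A ∈ 𝒰 × Diagonal (slice x) A) → _
        conclude (𝒰 , isU , avoids , meets) = 𝒰 , diagonal⇒PPoint isU meets , avoids

  theorem : (I : Family ℕ) → IsIdeal I → Borel I →
    (ContinuumHypothesis → PPointsCoincideWith I → I ≤K Fin² × ¬ FσExtendable I) ×
    (I ≤K Fin² × ¬ FσExtendable I → PPointsCoincideWith I)
  theorem I isI borel = necessity , sufficiency
    where
      necessity : ContinuumHypothesis → PPointsCoincideWith I → I ≤K Fin² × ¬ FσExtendable I
      necessity ch coincide =
        dne (λ I≰Fin² → no-counterexample (I-ultrafilter-not-PPoint order I≰Fin²)) ,
        λ (J , isJ , J-Fσ , I⊆J) →
          no-PPoint-avoiding I⊆J (PPoint-avoiding isJ (Fσ-σ-closed isJ J-Fσ) order)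
        where
          order = CH⇒Ω₁Order ch

          no-counterexample : ¬ (Σ[ 𝒰 ∈ Family ℕ ] I -ultrafilter 𝒰 × ¬ PPoint 𝒰)
          no-counterexample (𝒰 , I-ultra , ¬pp) = ¬pp (Equivalence.from (coincide 𝒰) I-ultra)

          no-PPoint-avoiding : ∀ {J} → I ⊆ J → ¬ (Σ[ 𝒰 ∈ Family ℕ ] PPoint 𝒰 × (∀ A → A ∈ J → A ∉ 𝒰))
          no-PPoint-avoiding I⊆J (𝒰 , pp , avoids) = proj₂ (Equivalence.to (coincide 𝒰) pp)
            (id , λ B B∈I → Ultra.∁∉ (proj₁ pp) (avoids B (I⊆J B∈I)))

      sufficiency : I ≤K Fin² × ¬ FσExtendable I → PPointsCoincideWith I
      sufficiency (I≤Fin² , ¬extendable) 𝒰 =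
        mk⇔ (PPoint⇒I-ultrafilter isI borel ¬extendable) (I-ultrafilter⇒PPoint I≤Fin²)

theorem7p4 : (∀ {ℓ} → ExcludedMiddle ℓ) →
    (∀ {a b} → Extensionality a b) →
    (I : Family ℕ) → IsIdeal I → Borel I →
    (ContinuumHypothesis → PPointsCoincideWith I → I ≤K Fin² × ¬ FσExtendable I) ×
    (I ≤K Fin² × ¬ FσExtendable I → PPointsCoincideWith I)
theorem7p4 em ext = Classical.theorem em ext
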